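{- For all integers $n\ge 1$, $$N_n(x)=\frac{1}{n!}\sum_{w\in\mathfrak{S}_n}B_w(x)\,E_{\ell_w}(x).$$
   Context: $\mathfrak{S}_n$ is the symmetric group on $\{1,\ldots,n\}$. The Narayana polynomial is $N_n(x)=\sum_{k=0}^{n-1}\frac1n\binom nk\binom n{k+1}x^k$. The Eulerian polynomial is $E_n(x)=\sum_{w\in\mathfrak{S}_n}x^{\operatorname{des}(w)}$, where $\operatorname{des}(w)=|\{i: w_i>w_{i+1}\}|$. The type B Narayana polynomial is $B_n(x)=\sum_{k=0}^{n-1}\binom{n-1}{k}^2x^k$. For $w\in\mathfrak{S}_n$ with cycle type $(\lambda_1,\ldots,\lambda_\ell)$ (fixed points counted as cycles), $\ell_w=\ell$ is the number of cycles of $w$ and $B_w(x)=B_{\lambda_1}(x)\cdots B_{\lambda_\ell}(x)$. -}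

module Defs where

open import Data.Fin.Base as Fin using (Fin; zero; suc; toℕ; fromℕ<)
import Data.Fin.Properties as Fin
open import Data.Fin.Permutation as Perm
  using (Permutation′; _⟨$⟩ʳ_; insert; insert-punchIn; insert-remove; remove)
open import Data.Integer.Base using (+_)
open import Data.List.Base
  using (List; []; _∷_; _++_; map; foldr; filter; length; replicate; allFin;
         applyUpTo; cartesianProductWith)
open import Data.List.Membership.Propositional.Properties using (∈-allFin)
import Data.List.Membership.Setoid.Properties as Membership
open import Data.List.Relation.Unary.All using ([])
open import Data.List.Relation.Unary.AllPairs using ([]; _∷_)
open import Data.List.Relation.Unary.Any using (here)
open import Data.List.Relation.Unary.Enumerates.Setoid using (IsEnumeration)
open import Data.List.Relation.Unary.Unique.Propositional.Properties using (allFin⁺)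
open import Data.List.Relation.Unary.Unique.Setoid using (Unique)
import Data.List.Relation.Unary.Unique.Setoid.Properties as Unique
open import Data.Nat.Base as ℕ using (ℕ; zero; suc; NonZero; _!)
open import Data.Nat.Combinatorics using (_C_)
open import Data.Nat.DivMod using (_/_; _%_; m≡m%n+[m/n]*n; m%n<n)
open import Data.Nat.GeneralisedArithmetic using (iterate)
import Data.Nat.Properties as ℕ
open import Data.Product.Base using (∃; _×_; _,_)
open import Data.Rational.Base as ℚ using (ℚ; 0ℚ; 1ℚ)
open import Level using (0ℓ)
open import Relation.Binary.Bundles using (Setoid)
open import Relation.Binary.PropositionalEquality
open import Relation.Nullary.Decidable using (map′; _×-dec_; _→-dec_)
open import Relation.Unary using (Decidable)

-- a₀ ∷ a₁ ∷ … ∷ [] stands for a₀ + a₁ x + …; trailing zeros are allowed,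
-- so polynomials are compared by _≈ₚ_ and not by _≡_.
Poly : Set
Poly = List ℚ

coeff : Poly → ℕ → ℚ
coeff []      _       = 0ℚ
coeff (a ∷ p) zero    = a
coeff (a ∷ p) (suc k) = coeff p k

infix 4 _≈ₚ_
_≈ₚ_ : Poly → Poly → Set
p ≈ₚ q = ∀ k → coeff p k ≡ coeff q k

0ₚ 1ₚ : Poly
0ₚ = []
1ₚ = 1ℚ ∷ []

infixl 6 _+ₚ_
_+ₚ_ : Poly → Poly → Poly
[]      +ₚ q       = q
(a ∷ p) +ₚ []      = a ∷ p
(a ∷ p) +ₚ (b ∷ q) = (a ℚ.+ b) ∷ (p +ₚ q)

infixr 7 _·ₚ_
_·ₚ_ : ℚ → Poly → Poly
c ·ₚ p = map (c ℚ.*_) p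

infixl 7 _*ₚ_
_*ₚ_ : Poly → Poly → Poly
[]      *ₚ q = []
(a ∷ p) *ₚ q = a ·ₚ q +ₚ (0ℚ ∷ p *ₚ q)

x^_ : ℕ → Poly
x^ k = replicate k 0ℚ ++ 1ₚ

sumₚ productₚ : List Poly → Poly
sumₚ     = foldr _+ₚ_ 0ₚ
productₚ = foldr _*ₚ_ 1ₚ

fromℕ : ℕ → ℚ
fromℕ m = + m ℚ./ 1

-- 𝔖ₙ, acting on Fin n = {0, …, n-1} instead of {1, …, n}: a permutation of
-- suc n points is given by the image of 0 and the relative order of the other
-- images. permutations-complete and permutations-unique show that every
-- permutation is listed exactly once up to pointwise equality.
permutations : ∀ n → List (Permutation′ n)
permutations zero    = Perm.id ∷ []
permutations (suc n) = cartesianProductWith (insert zero) (allFin (suc n)) (permutations n)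

permSetoid : ℕ → Setoid 0ℓ 0ℓ
permSetoid n = record
  { Carrier       = Permutation′ n
  ; _≈_           = Perm._≈_
  ; isEquivalence = record
    { refl  = λ _ → refl
    ; sym   = λ e i → sym (e i)
    ; trans = λ e f i → trans (e i) (f i)
    }
  }

permutations-complete : ∀ n → IsEnumeration (permSetoid n) (permutations n)
permutations-complete zero    π = here λ ()
permutations-complete (suc n) π =
  Membership.∈-resp-≈ (permSetoid (suc n))
    {x = insert zero (π ⟨$⟩ʳ zero) (remove zero π)} {y = π}
    (insert-remove zero π)
    (Membership.∈-cartesianProductWith⁺
      (setoid (Fin (suc n))) (permSetoid n) (permSetoid (suc n))
      (λ {i} {j} {ρ} {σ} → insert-cong {i} {j} {ρ} {σ})
      (∈-allFin (π ⟨$⟩ʳ zero)) (permutations-complete n (remove zero π)))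
  where
  insert-cong : ∀ {i j : Fin (suc n)} {ρ σ : Permutation′ n} → i ≡ j → ρ Perm.≈ σ →
                insert zero i ρ Perm.≈ insert zero j σ
  insert-cong refl e zero    = refl
  insert-cong {i} {ρ = ρ} {σ} refl e (suc k) =
    trans (insert-punchIn zero i ρ k)
      (trans (cong (Fin.punchIn i) (e k)) (sym (insert-punchIn zero i σ k)))

permutations-unique : ∀ n → Unique (permSetoid n) (permutations n)
permutations-unique zero    = [] ∷ []
permutations-unique (suc n) =
  Unique.cartesianProductWith⁺
    (setoid (Fin (suc n))) (permSetoid n) (permSetoid (suc n))
    (insert zero) (λ {i} {j} {ρ} {σ} → insert-injective {i} {j} {ρ} {σ})
    (allFin⁺ (suc n)) (permutations-unique n)
  where
  insert-injective : ∀ {i j : Fin (suc n)} {ρ σ : Permutation′ n} →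
                     insert zero i ρ Perm.≈ insert zero j σ → i ≡ j × ρ Perm.≈ σ
  insert-injective {i} {j} {ρ} {σ} e with e zero
  ... | refl = refl , λ k → Fin.punchIn-injective i _ _
    (trans (sym (insert-punchIn zero i ρ k))
      (trans (e (suc k)) (insert-punchIn zero i σ k)))

count : ∀ {n} {P : Fin n → Set} → Decidable P → ℕ
count {n} P? = length (filter P? (allFin n))

module _ {n : ℕ} (w : Permutation′ n) where

  IsDescent : Fin n → Set
  IsDescent i = ∃ λ j → toℕ j ≡ suc (toℕ i) × (w ⟨$⟩ʳ j) Fin.< (w ⟨$⟩ʳ i)

  isDescent? : Decidable IsDescent
  isDescent? i = Fin.any? λ j →
    (toℕ j ℕ.≟ suc (toℕ i)) ×-dec ((w ⟨$⟩ʳ j) Fin.<? (w ⟨$⟩ʳ i))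

  des : ℕ
  des = count isDescent?

  power : ℕ → Fin n → Fin n
  power k i = iterate (w ⟨$⟩ʳ_) i k

  SameCycle : Fin n → Fin n → Set
  SameCycle i j = ∃ λ k → power k i ≡ j

  power-+ : ∀ k l i → power (k ℕ.+ l) i ≡ power l (power k i)
  power-+ zero    l i = refl
  power-+ (suc k) l i = power-+ k l (w ⟨$⟩ʳ i)

  power-injective : ∀ k {i j} → power k i ≡ power k j → i ≡ j
  power-injective zero    e = e
  power-injective (suc k) e =
    trans (sym (Perm.inverseˡ w))
      (trans (cong (w Perm.⟨$⟩ˡ_) (power-injective k e)) (Perm.inverseˡ w))

  power-* : ∀ {d i} → power d i ≡ i → ∀ q → power (q ℕ.* d) i ≡ i
  power-* e zero = refl
  power-* {d} {i} e (suc q) =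
    trans (power-+ d (q ℕ.* d) i) (trans (cong (power (q ℕ.* d)) e) (power-* e q))

  period : ∀ i → ∃ λ d → NonZero d × d ℕ.≤ n × power d i ≡ i
  period i with Fin.pigeonhole (ℕ.n<1+n n) (λ k → power (toℕ k) i)
  ... | a , b , a<b , e =
    toℕ b ℕ.∸ toℕ a
    , ℕ.>-nonZero (ℕ.m<n⇒0<n∸m a<b)
    , ℕ.≤-trans (ℕ.m∸n≤m (toℕ b) (toℕ a)) (Fin.toℕ≤pred[n] b)
    , power-injective (toℕ a)
        (trans (sym (power-+ (toℕ b ℕ.∸ toℕ a) (toℕ a) i))
          (trans (cong (λ k → power k i) (ℕ.m∸n+n≡m (ℕ.<⇒≤ a<b))) (sym e)))

  bounded : ∀ i j → SameCycle i j → ∃ λ (k : Fin n) → power (toℕ k) i ≡ j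
  bounded i j (k , e) with period i
  ... | d , d≢0 , d≤n , pd =
    let instance _ = d≢0
        r<n = ℕ.<-≤-trans (m%n<n k d) d≤n
    in fromℕ< r<n , (begin
      power (toℕ (fromℕ< r<n)) i        ≡⟨ cong (λ l → power l i) (Fin.toℕ-fromℕ< r<n) ⟩
      power (k % d) i                   ≡⟨ cong (power (k % d)) (power-* pd (k / d)) ⟨
      power (k % d) (power (k / d ℕ.* d) i)
                                      ≡⟨ power-+ (k / d ℕ.* d) (k % d) i ⟨
      power (k / d ℕ.* d ℕ.+ k % d) i   ≡⟨ cong (λ l → power l i) (ℕ.+-comm (k / d ℕ.* d) (k % d)) ⟩
      power (k % d ℕ.+ k / d ℕ.* d) i   ≡⟨ cong (λ l → power l i) (m≡m%n+[m/n]*n k d) ⟨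
      power k i                         ≡⟨ e ⟩
      j                                 ∎)
    where open ≡-Reasoning

  sameCycle? : ∀ i → Decidable (SameCycle i)
  sameCycle? i j =
    map′ (λ { (k , e) → toℕ k , e }) (bounded i j) (Fin.any? λ k → power (toℕ k) i Fin.≟ j)

  -- Each cycle is represented by its least element.
  IsLeader : Fin n → Set
  IsLeader i = ∀ j → SameCycle i j → i Fin.≤ j

  isLeader? : Decidable IsLeader
  isLeader? i = Fin.all? λ j → sameCycle? i j →-dec (i Fin.≤? j)

  -- The parts are listed in order of the cycles' least elements and are not
  -- sorted by size.
  cycleType : List ℕ
  cycleType = map (λ i → count (sameCycle? i)) (filter isLeader? (allFin n))

  numCycles : ℕ
  numCycles = length cycleType

-- applyUpTo c n is the coefficient list of Σ_{k=0}^{n-1} c k · x^k.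
narayana : ∀ n .{{_ : NonZero n}} → Poly
narayana n = applyUpTo (λ k → (+ 1 ℚ./ n) ℚ.* fromℕ (n C k) ℚ.* fromℕ (n C suc k)) n

eulerian : ℕ → Poly
eulerian n = sumₚ (map (λ w → x^ des w) (permutations n))

-- Only used for n ≥ 1, since cycles are nonempty.
narayanaB : ℕ → Poly
narayanaB n = applyUpTo (λ k → fromℕ (((n ℕ.∸ 1) C k) ℕ.^ 2)) n

narayanaB-perm : ∀ {n} → Permutation′ n → Poly
narayanaB-perm w = productₚ (map narayanaB (cycleType w))

1/_! : ℕ → ℚ
1/ n ! = (+ 1) ℚ./ (n !)
  where instance _ = n ℕ.!≢0

{-# OPTIONS --safe #-}
module Submission where

-- Work with power series in u over ℚ⟦x⟧. Put φ = (1 + u)(1 + xu) and y = u/φ, so that ∂ = d/dy is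
-- βφ·d/du with β = φ/(φ − uφ′). By Lagrange inversion, 1 + u = 1 + Σ Nₙ yⁿ and β = Σ Bₖ₊₁ yᵏ, that is,
-- ∂ⁿ(1 + u) is n!·Nₙ at u = 0 and bₖ = ∂ᵏ⁻¹β/(k−1)! is Bₖ at u = 0.
-- Let g_ℓ = (φ·d/du)^ℓ (1 + u); its value at u = 0 is E_ℓ. Since ∂bₖ = k·bₖ₊₁ and ∂g_ℓ = b₁g_ℓ₊₁, the
-- Leibniz rule turns the product of the bₖ over the cycles of w and of g_ℓ, ℓ the number of cycles, into
-- the sum of such products over all ways to adjoin a point to w: as a fixed point, or in front of one of the
-- points of w in its cycle. Hence ∂ⁿg₀ is the sum of these products over 𝔖ₙ; evaluate it at u = 0.
-- For the Eulerian polynomials, write T = φ·d/du. The permutations in 𝔖ₙ₊₁ whose first letter is the i-th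
-- smallest, i counted from 0, have descent polynomial (T − (1 − x))ⁱ Tⁿ⁻ⁱ (1 + u) at u = 0: multiplied by
-- 1 − x, the recursion on the first letter telescopes.

open import Defs
open import Algebra.Bundles using (CommutativeRing; CommutativeMonoid)
import Algebra.Definitions.RawMonoid as Multiple
open import Data.Bool.Base using (Bool; true; false; if_then_else_; T)
open import Data.Fin.Base as Fin using (Fin; toℕ; punchIn)
import Data.Fin.Induction as Fin
import Data.Fin.Properties as Fin
open import Data.Fin.Permutation as Perm
  using (Permutation′; _⟨$⟩ʳ_; lift₀; transpose; remove; insert)
import Data.Integer.Base as ℤ
import Data.Integer.Properties as ℤ
open import Data.List.Base as List
  using (List; []; _∷_; _++_; map; foldr; filter; length; tabulate; allFin; applyUpTo; cartesianProductWith)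
open import Data.List.Membership.Propositional using (lose)
open import Data.List.Membership.Propositional.Properties using (∈-allFin; ∈-filter⁺)
import Data.List.Membership.Setoid as Membership
import Data.List.Membership.Setoid.Properties as Membershipₚ
import Data.List.Properties as List
open import Data.List.Relation.Unary.All as All using (All; []; _∷_)
import Data.List.Relation.Unary.All.Properties as All
open import Data.List.Relation.Unary.AllPairs using (AllPairs; []; _∷_)
open import Data.List.Relation.Unary.Any using (Any; here; there; _─_; index)
open import Data.List.Relation.Unary.Unique.Propositional.Properties
  using (allFin⁺) renaming (filter⁺ to unique-filter)
open import Data.List.Relation.Unary.Unique.Setoid using (Unique)
open import Data.Nat.Base as ℕ using (ℕ; zero; suc; z≤n; s≤s; NonZero; _!; _<ᵇ_)
open import Data.Nat.Combinatorics
  using (_C_; nCn≡1; nCk+nC[k+1]≡[n+1]C[k+1]; k>n⇒nCk≡0; nCk≡nC[n∸k])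
import Data.Nat.Properties as ℕ
open import Data.Product.Base using (∃; _×_; _,_; proj₁; proj₂)
open import Data.Rational.Base as ℚ using (ℚ; 0ℚ; 1ℚ; toℚᵘ)
import Data.Rational.Properties as ℚ
open import Data.Rational.Unnormalised.Base as ℚᵘ using (mkℚᵘ; *≡*)
import Data.Rational.Unnormalised.Properties as ℚᵘ
open import Function.Base using (_∘_)
open import Induction.WellFounded using (Acc; acc)
open import Level using (Level; 0ℓ; _⊔_) renaming (suc to lsuc)
open import Relation.Binary.Bundles using (Setoid)
open import Relation.Binary.Core using (Rel)
open import Relation.Binary.Definitions using () renaming (Decidable to Decidable₂)
open import Relation.Binary.PropositionalEquality as ≡ using (_≡_; _≢_)
open import Relation.Binary.Structures using (IsEquivalence)
open import Relation.Nullary using (¬_; Dec; yes; no; does; contradiction)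
open import Relation.Nullary.Decidable using (¬?; _×-dec_; _→-dec_)
open import Relation.Unary using (Decidable; _≐_)

-- Power series

-- The inverse series of y is never formed. Everything stays in the coordinate u, where d/dy is the
-- derivation βφ·d/du because dy/du = (φ - uφ′)/φ²; since u and y vanish together, Taylor
-- coefficients in y are values at u = 0. The constant 1 - x enters twice. In the recursion on the
-- first letter it is the difference between the weight 1 of an ascent and the weight x of a
-- descent. For T it is the eigenvalue of r = (1 + u)/(1 + xu): T(1 + u) = φ and T(1 + xu) = xφ give
-- T r = (1 - x)r. That the two agree is what solves the recursion. It is solved over ℚ⟦x⟧, where 1
-- - x can be cancelled. No single way of building 𝔖ₙ₊₁ from 𝔖ₙ suits both statistics: descents
-- follow a letter put in front, as in `permutations`, and cycles follow a point adjoined to a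
-- cycle, as in `attach`. A reindexing of the sum links the two.

module PowerSeries {c ℓ : Level} (R : CommutativeRing c ℓ) where
  open CommutativeRing R
  open import Algebra.Properties.Semiring.Mult semiring renaming (_×_ to infixr 8 _•_)
  open import Algebra.Properties.CommutativeMonoid.Mult +-commutativeMonoid using (×-distrib-+)
  open import Relation.Binary.Reasoning.Setoid setoid

  open import Algebra.Properties.CommutativeSemigroup
    (CommutativeMonoid.commutativeSemigroup +-commutativeMonoid) using (interchange)

  Series : Set c
  Series = ℕ → Carrier

  infix 4 _≋_
  _≋_ : Series → Series → Set ℓ
  f ≋ g = ∀ n → f n ≈ g n

  const : Carrier → Series
  const a zero    = a
  const a (suc _) = 0#

  infixl 6 _⊕_
  _⊕_ : Series → Series → Series
  (f ⊕ g) n = f n + g n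

  infixl 7 _⊛_
  _⊛_ : Series → Series → Series
  (f ⊛ g) zero    = f 0 * g 0
  (f ⊛ g) (suc n) = f 0 * g (suc n) + (f ∘ suc ⊛ g) n

  ⊛-cong : ∀ {f f′ g g′} → f ≋ f′ → g ≋ g′ → f ⊛ g ≋ f′ ⊛ g′
  ⊛-cong p q zero    = *-cong (p 0) (q 0)
  ⊛-cong p q (suc n) = +-cong (*-cong (p 0) (q (suc n))) (⊛-cong (p ∘ suc) q n)

  ⊛-tailʳ : ∀ f g n → (f ⊛ g) (suc n) ≈ (f ⊛ g ∘ suc) n + f (suc n) * g 0
  ⊛-tailʳ f g zero    = refl
  ⊛-tailʳ f g (suc n) = begin
    f 0 * g (2 ℕ.+ n) + (f ∘ suc ⊛ g) (suc n)
      ≈⟨ +-congˡ (⊛-tailʳ (f ∘ suc) g n) ⟩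
    f 0 * g (2 ℕ.+ n) + ((f ∘ suc ⊛ g ∘ suc) n + f (2 ℕ.+ n) * g 0)
      ≈⟨ +-assoc _ _ _ ⟨
    (f ⊛ g ∘ suc) (suc n) + f (2 ℕ.+ n) * g 0 ∎

  ⊛-comm : ∀ f g → f ⊛ g ≋ g ⊛ f
  ⊛-comm f g zero    = *-comm _ _
  ⊛-comm f g (suc n) = begin
    f 0 * g (suc n) + (f ∘ suc ⊛ g) n  ≈⟨ +-cong (*-comm _ _) (⊛-comm (f ∘ suc) g n) ⟩
    g (suc n) * f 0 + (g ⊛ f ∘ suc) n  ≈⟨ +-comm _ _ ⟩
    (g ⊛ f ∘ suc) n + g (suc n) * f 0  ≈⟨ ⊛-tailʳ g f n ⟨
    (g ⊛ f) (suc n)                    ∎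

  ⊛-distribʳ : ∀ h f g → (f ⊕ g) ⊛ h ≋ (f ⊛ h) ⊕ (g ⊛ h)
  ⊛-distribʳ h f g zero    = distribʳ _ _ _
  ⊛-distribʳ h f g (suc n) = trans (+-cong (distribʳ _ _ _) (⊛-distribʳ h (f ∘ suc) (g ∘ suc) n))
                                   (interchange _ _ _ _)

  ⊛-scale : ∀ a f g → (λ n → a * f n) ⊛ g ≋ λ n → a * (f ⊛ g) n
  ⊛-scale a f g zero    = *-assoc _ _ _
  ⊛-scale a f g (suc n) = trans (+-cong (*-assoc _ _ _) (⊛-scale a (f ∘ suc) g n)) (sym (distribˡ _ _ _))

  ⊛-assoc : ∀ f g h → (f ⊛ g) ⊛ h ≋ f ⊛ (g ⊛ h)
  ⊛-assoc f g h zero    = *-assoc _ _ _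
  ⊛-assoc f g h (suc n) = begin
    (f 0 * g 0) * h (suc n) + (((λ m → f 0 * g (suc m)) ⊕ (f ∘ suc ⊛ g)) ⊛ h) n
      ≈⟨ +-cong (*-assoc _ _ _) (⊛-distribʳ h (λ m → f 0 * g (suc m)) (f ∘ suc ⊛ g) n) ⟩
    f 0 * (g 0 * h (suc n)) + (((λ m → f 0 * g (suc m)) ⊛ h) n + ((f ∘ suc ⊛ g) ⊛ h) n)
      ≈⟨ +-assoc _ _ _ ⟨
    (f 0 * (g 0 * h (suc n)) + ((λ m → f 0 * g (suc m)) ⊛ h) n) + ((f ∘ suc ⊛ g) ⊛ h) n
      ≈⟨ +-cong (trans (+-congˡ (⊛-scale (f 0) (g ∘ suc) h n)) (sym (distribˡ _ _ _)))
                (⊛-assoc (f ∘ suc) g h n) ⟩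
    f 0 * (g ⊛ h) (suc n) + (f ∘ suc ⊛ (g ⊛ h)) n ∎

  0-⊛ : ∀ {f} → f ≋ (λ _ → 0#) → ∀ g → f ⊛ g ≋ λ _ → 0#
  0-⊛ p g zero    = trans (*-congʳ (p 0)) (zeroˡ _)
  0-⊛ p g (suc n) = trans (+-cong (trans (*-congʳ (p 0)) (zeroˡ _)) (0-⊛ (p ∘ suc) g n)) (+-identityˡ _)

  const-⊛ : ∀ a f → const a ⊛ f ≋ λ n → a * f n
  const-⊛ a f zero    = refl
  const-⊛ a f (suc n) = trans (+-congˡ (0-⊛ (λ _ → refl) f n)) (+-identityʳ _)

  ⊛-identityˡ : ∀ f → const 1# ⊛ f ≋ f
  ⊛-identityˡ f n = trans (const-⊛ 1# f n) (*-identityˡ _)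

  seriesRing : CommutativeRing c ℓ
  seriesRing = record
    { Carrier = Series
    ; _≈_ = _≋_
    ; _+_ = _⊕_
    ; _*_ = _⊛_
    ; -_ = λ f n → - f n
    ; 0# = λ _ → 0#
    ; 1# = const 1#
    ; isCommutativeRing = record
      { isRing = record
        { +-isAbelianGroup = record
          { isGroup = record
            { isMonoid = record
              { isSemigroup = record
                { isMagma = record
                  { isEquivalence = record
                    { refl = λ _ → refl
                    ; sym = λ p n → sym (p n)
                    ; trans = λ p q n → trans (p n) (q n)
                    }
                  ; ∙-cong = λ p q n → +-cong (p n) (q n)
                  }
                ; assoc = λ f g h n → +-assoc _ _ _
                }
              ; identity = (λ f n → +-identityˡ _) , (λ f n → +-identityʳ _)
              }
            ; inverse = (λ f n → -‿inverseˡ _) , (λ f n → -‿inverseʳ _)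
            ; ⁻¹-cong = λ p n → -‿cong (p n)
            }
          ; comm = λ f g n → +-comm _ _
          }
        ; *-cong = ⊛-cong
        ; *-assoc = ⊛-assoc
        ; *-identity = ⊛-identityˡ , λ f n → trans (⊛-comm f (const 1#) n) (⊛-identityˡ f n)
        ; distrib = (λ f g h n → trans (⊛-comm f (g ⊕ h) n)
                        (trans (⊛-distribʳ f g h n) (+-cong (⊛-comm g f n) (⊛-comm h f n))))
                  , ⊛-distribʳ
        }
      ; *-comm = ⊛-comm
      }
    }

  shift : Series → Series
  shift f zero    = 0#
  shift f (suc n) = f n

  shift-⊛ : ∀ f g → shift f ⊛ g ≋ shift (f ⊛ g)
  shift-⊛ f g zero    = zeroˡ _
  shift-⊛ f g (suc n) = trans (+-congʳ (zeroˡ _)) (+-identityˡ _)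

  D : Series → Series
  D f n = suc n • f (suc n)

  D-cong : ∀ {f g} → f ≋ g → D f ≋ D g
  D-cong p n = ×-congʳ (suc n) (p (suc n))

  D-⊕ : ∀ f g → D (f ⊕ g) ≋ D f ⊕ D g
  D-⊕ f g n = ×-distrib-+ _ _ (suc n)

  private
    -- Write t for the variable. From f = f(0) + t·f₁ follows f′ = f₁ + t·f₁′; multiply by g and
    -- compare coefficients.
    ⊛-D-suc : ∀ f g n → (D f ⊛ g) (suc n) ≈ (f ∘ suc ⊛ g) (suc n) + (D (f ∘ suc) ⊛ g) n
    ⊛-D-suc f g n = begin
      (D f ⊛ g) (suc n)                                          ≈⟨ ⊛-cong D-suc (λ _ → refl) (suc n) ⟩
      ((f ∘ suc ⊕ shift (D (f ∘ suc))) ⊛ g) (suc n)              ≈⟨ ⊛-distribʳ g (f ∘ suc) (shift (D (f ∘ suc))) (suc n) ⟩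
      (f ∘ suc ⊛ g) (suc n) + (shift (D (f ∘ suc)) ⊛ g) (suc n)  ≈⟨ +-congˡ (shift-⊛ (D (f ∘ suc)) g (suc n)) ⟩
      (f ∘ suc ⊛ g) (suc n) + (D (f ∘ suc) ⊛ g) n                ∎
      where
      D-suc : D f ≋ f ∘ suc ⊕ shift (D (f ∘ suc))
      D-suc zero    = refl
      D-suc (suc n) = refl

  D-⊛ : ∀ f g → D (f ⊛ g) ≋ (D f ⊛ g) ⊕ (f ⊛ D g)
  D-⊛ f g zero = begin
    1 • (f 0 * g 1 + f 1 * g 0)        ≈⟨ ×-homo-1 _ ⟩
    f 0 * g 1 + f 1 * g 0              ≈⟨ +-comm _ _ ⟩
    f 1 * g 0 + f 0 * g 1              ≈⟨ +-cong (*-congʳ (×-homo-1 _)) (*-congˡ (×-homo-1 _)) ⟨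
    1 • f 1 * g 0 + f 0 * (1 • g 1)    ∎
  D-⊛ f g (suc n) = begin
    (f⊛g) (2 ℕ.+ n) + suc n • (f 0 * g (2 ℕ.+ n) + (f ∘ suc ⊛ g) (suc n))
      ≈⟨ +-congˡ (×-distrib-+ _ _ (suc n)) ⟩
    (f⊛g) (2 ℕ.+ n) + (suc n • (f 0 * g (2 ℕ.+ n)) + D (f ∘ suc ⊛ g) n)
      ≈⟨ +-congˡ (+-cong (sym (×-comm-* (suc n) _ _)) (D-⊛ (f ∘ suc) g n)) ⟩
    (f 0 * g (2 ℕ.+ n) + (f ∘ suc ⊛ g) (suc n)) + (f 0 * D (g ∘ suc) n + ((D (f ∘ suc) ⊛ g) n + (f ∘ suc ⊛ D g) n))
      ≈⟨ solve 5 (λ a b c d e → (a :+ b) :+ (c :+ (d :+ e)) := (b :+ d) :+ ((a :+ c) :+ e)) refl _ _ _ _ _ ⟩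
    ((f ∘ suc ⊛ g) (suc n) + (D (f ∘ suc) ⊛ g) n) + ((f 0 * g (2 ℕ.+ n) + f 0 * D (g ∘ suc) n) + (f ∘ suc ⊛ D g) n)
      ≈⟨ +-cong (⊛-D-suc f g n) (+-congʳ (distribˡ _ _ _)) ⟨
    (D f ⊛ g) (suc n) + (f ⊛ D g) (suc n) ∎
    where
    open import Algebra.Solver.Ring.NaturalCoefficients.Default commutativeSemiring
    f⊛g = f ⊛ g

-- Finite sums and products

module Sum {c ℓ : Level} (R : CommutativeRing c ℓ) where
  open CommutativeRing R
  open import Algebra.Properties.CommutativeSemigroup
    (CommutativeMonoid.commutativeSemigroup +-commutativeMonoid) using (interchange)

  ∑ : {A : Set} → List A → (A → Carrier) → Carrier
  ∑ xs f = foldr (λ x acc → f x + acc) 0# xs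

  ∏ : {A : Set} → List A → (A → Carrier) → Carrier
  ∏ xs f = foldr (λ x acc → f x * acc) 1# xs

  ∑-cong : ∀ {A} (xs : List A) {f g} → (∀ x → f x ≈ g x) → ∑ xs f ≈ ∑ xs g
  ∑-cong []       p = refl
  ∑-cong (x ∷ xs) p = +-cong (p x) (∑-cong xs p)

  ∏-cong : ∀ {A} (xs : List A) {f g} → (∀ x → f x ≈ g x) → ∏ xs f ≈ ∏ xs g
  ∏-cong []       p = refl
  ∏-cong (x ∷ xs) p = *-cong (p x) (∏-cong xs p)

  ∑-++ : ∀ {A} (xs ys : List A) f → ∑ (xs ++ ys) f ≈ ∑ xs f + ∑ ys f
  ∑-++ []       ys f = sym (+-identityˡ _)
  ∑-++ (x ∷ xs) ys f = trans (+-congˡ (∑-++ xs ys f)) (sym (+-assoc _ _ _))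

  ∑-map : ∀ {A B : Set} (h : A → B) xs f → ∑ (map h xs) f ≡ ∑ xs (f ∘ h)
  ∑-map h []       f = ≡.refl
  ∑-map h (x ∷ xs) f = ≡.cong (f (h x) +_) (∑-map h xs f)

  ∏-map : ∀ {A B : Set} (h : A → B) xs f → ∏ (map h xs) f ≡ ∏ xs (f ∘ h)
  ∏-map h []       f = ≡.refl
  ∏-map h (x ∷ xs) f = ≡.cong (f (h x) *_) (∏-map h xs f)

  ∑-0 : ∀ {A : Set} (xs : List A) → ∑ xs (λ _ → 0#) ≈ 0#
  ∑-0 []       = refl
  ∑-0 (x ∷ xs) = trans (+-identityˡ _) (∑-0 xs)

  ∑-+ : ∀ {A} (xs : List A) f g → ∑ xs (λ x → f x + g x) ≈ ∑ xs f + ∑ xs g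
  ∑-+ []       f g = sym (+-identityˡ _)
  ∑-+ (x ∷ xs) f g = trans (+-congˡ (∑-+ xs f g)) (interchange _ _ _ _)

  *-∑ : ∀ {A} a (xs : List A) f → a * ∑ xs f ≈ ∑ xs (λ x → a * f x)
  *-∑ a []       f = zeroʳ a
  *-∑ a (x ∷ xs) f = trans (distribˡ _ _ _) (+-congˡ (*-∑ a xs f))

  ∑-swap : ∀ {A B} (xs : List A) (ys : List B) (f : A → B → Carrier) →
           ∑ xs (λ x → ∑ ys (f x)) ≈ ∑ ys (λ y → ∑ xs (λ x → f x y))
  ∑-swap []       ys f = sym (∑-0 ys)
  ∑-swap (x ∷ xs) ys f = trans (+-congˡ (∑-swap xs ys f)) (sym (∑-+ ys (f x) (λ y → ∑ xs (λ x → f x y))))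

  ∑-allFin-suc : ∀ {n} (f : Fin (suc n) → Carrier) → ∑ (allFin (suc n)) f ≈ f Fin.zero + ∑ (allFin n) (f ∘ Fin.suc)
  ∑-allFin-suc {n} f = +-congˡ (reflexive
    (≡.trans (≡.cong (λ is → ∑ is f) (≡.sym (List.map-tabulate {n = n} (λ i → i) Fin.suc))) (∑-map Fin.suc (allFin n) f)))

  ∑-cartesianProductWith : ∀ {A B C : Set} (h : A → B → C) xs ys f →
                           ∑ (cartesianProductWith h xs ys) f ≈ ∑ xs (λ x → ∑ ys (λ y → f (h x y)))
  ∑-cartesianProductWith h []       ys f = refl
  ∑-cartesianProductWith h (x ∷ xs) ys f =
    trans (∑-++ (map (h x) ys) _ f)
      (+-cong (reflexive (∑-map (h x) ys f)) (∑-cartesianProductWith h xs ys f))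

-- Differential rings

record DifferentialRing (c ℓ : Level) : Set (lsuc (c ⊔ ℓ)) where
  field
    commutativeRing : CommutativeRing c ℓ
  open CommutativeRing commutativeRing public hiding (zero)
  field
    ∂      : Carrier → Carrier
    ∂-cong : ∀ {a b} → a ≈ b → ∂ a ≈ ∂ b
    ∂-+    : ∀ a b → ∂ (a + b) ≈ ∂ a + ∂ b
    ∂-*    : ∀ a b → ∂ (a * b) ≈ ∂ a * b + a * ∂ b

  open import Algebra.Properties.Semiring.Mult semiring public renaming (_×_ to infixr 8 _•_)
  open Sum commutativeRing public
  open import Algebra.Properties.AbelianGroup +-abelianGroup using (identityˡ-unique)

  ∂-0 : ∂ 0# ≈ 0#
  ∂-0 = identityˡ-unique _ _ (trans (sym (∂-+ 0# 0#)) (∂-cong (+-identityˡ 0#)))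

  ∂-1 : ∂ 1# ≈ 0#
  ∂-1 = identityˡ-unique _ _ (trans (sym (+-cong (*-identityʳ _) (*-identityˡ _)))
          (trans (sym (∂-* 1# 1#)) (∂-cong (*-identityˡ 1#))))

  ∂-∑ : ∀ {A} (xs : List A) f → ∂ (∑ xs f) ≈ ∑ xs (∂ ∘ f)
  ∂-∑ []       f = ∂-0
  ∂-∑ (x ∷ xs) f = trans (∂-+ _ _) (+-congˡ (∂-∑ xs f))

  open import Algebra.Properties.CommutativeMonoid.Mult +-commutativeMonoid using (×-distrib-+)
  open import Algebra.Properties.Semiring.Exp semiring using (_^_)
  open import Relation.Binary.Reasoning.Setoid setoid

  ∂-• : ∀ n a → ∂ (n • a) ≈ n • ∂ a
  ∂-• zero    a = ∂-0
  ∂-• (suc n) a = trans (∂-+ _ _) (+-congˡ (∂-• n a))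

  ∂-^ : ∀ a n → ∂ (a ^ suc n) ≈ suc n • (a ^ n * ∂ a)
  ∂-^ a zero = begin
    ∂ (a * 1#)                 ≈⟨ ∂-cong (*-identityʳ a) ⟩
    ∂ a                        ≈⟨ *-identityˡ _ ⟨
    1# * ∂ a                   ≈⟨ +-identityʳ _ ⟨
    1 • (1# * ∂ a)             ∎
  ∂-^ a (suc n) = begin
    ∂ (a * a ^ suc n)                              ≈⟨ ∂-* _ _ ⟩
    ∂ a * a ^ suc n + a * ∂ (a ^ suc n)            ≈⟨ +-cong (*-comm _ _) (*-congˡ (∂-^ a n)) ⟩
    a ^ suc n * ∂ a + a * (suc n • (a ^ n * ∂ a))  ≈⟨ +-congˡ (×-comm-* (suc n) _ _) ⟩
    a ^ suc n * ∂ a + suc n • (a * (a ^ n * ∂ a))  ≈⟨ +-congˡ (×-congʳ (suc n) (*-assoc _ _ _)) ⟨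
    suc (suc n) • (a ^ suc n * ∂ a)                ∎

  ∂^ : ℕ → Carrier → Carrier
  ∂^ zero    a = a
  ∂^ (suc n) a = ∂ (∂^ n a)

  ∂^-cong : ∀ n {a b} → a ≈ b → ∂^ n a ≈ ∂^ n b
  ∂^-cong zero    p = p
  ∂^-cong (suc n) p = ∂-cong (∂^-cong n p)

  ∂^-suc : ∀ n a → ∂^ (suc n) a ≡ ∂^ n (∂ a)
  ∂^-suc zero    a = ≡.refl
  ∂^-suc (suc n) a = ≡.cong ∂ (∂^-suc n a)

scaleDerivation : ∀ {c ℓ} (K : DifferentialRing c ℓ) → DifferentialRing.Carrier K → DifferentialRing c ℓ
scaleDerivation K t = record
  { commutativeRing = commutativeRing
  ; ∂      = λ a → t * ∂ a
  ; ∂-cong = λ p → *-congˡ (∂-cong p)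
  ; ∂-+    = λ a b → trans (*-congˡ (∂-+ a b)) (distribˡ _ _ _)
  ; ∂-*    = λ a b → trans (*-congˡ (∂-* a b))
      (solve 5 (λ t a a′ b b′ → t :* (a′ :* b :+ a :* b′) := t :* a′ :* b :+ a :* (t :* b′)) refl t a (∂ a) b (∂ b))
  }
  where
  open DifferentialRing K
  open import Algebra.Solver.Ring.NaturalCoefficients.Default commutativeSemiring

module DividedDerivative {c ℓ : Level} (K : DifferentialRing c ℓ) (inv : ℕ → DifferentialRing.Carrier K)
  (∂-inv : ∀ n → DifferentialRing._≈_ K (DifferentialRing.∂ K (inv n)) (DifferentialRing.0# K))
  (•-inv : ∀ n → DifferentialRing._≈_ K (DifferentialRing._•_ K (suc n) (inv n)) (DifferentialRing.1# K)) where
  open DifferentialRing K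
  open import Relation.Binary.Reasoning.Setoid setoid

  -- This is ∂ⁿ/n!, divided by one factor at a time; note that `inv n` is the inverse of n + 1.
  ∂! : ℕ → Carrier → Carrier
  ∂! zero    a = a
  ∂! (suc n) a = inv n * ∂ (∂! n a)

  ∂!-cong : ∀ n {a b} → a ≈ b → ∂! n a ≈ ∂! n b
  ∂!-cong zero    p = p
  ∂!-cong (suc n) p = *-congˡ (∂-cong (∂!-cong n p))

  ∂-∂! : ∀ n a → ∂ (∂! n a) ≈ suc n • ∂! (suc n) a
  ∂-∂! n a = begin
    ∂ (∂! n a)                     ≈⟨ *-identityˡ _ ⟨
    1# * ∂ (∂! n a)                ≈⟨ *-congʳ (•-inv n) ⟨
    (suc n • inv n) * ∂ (∂! n a)   ≈⟨ ×-assoc-* (suc n) _ _ ⟩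
    suc n • (inv n * ∂ (∂! n a))   ∎

  -- The recursion of `∂!` adds the outermost derivative, while Lagrange inversion peels off the
  -- innermost one. The two agree because the constants `inv n` pass through ∂.
  ∂!-suc : ∀ n a → ∂! (suc n) a ≈ inv n * ∂! n (∂ a)
  ∂!-suc zero    a = refl
  ∂!-suc (suc n) a = *-congˡ (begin
    ∂ (∂! (suc n) a)                                   ≈⟨ ∂-cong (∂!-suc n a) ⟩
    ∂ (inv n * ∂! n (∂ a))                             ≈⟨ ∂-* _ _ ⟩
    ∂ (inv n) * ∂! n (∂ a) + inv n * ∂ (∂! n (∂ a))    ≈⟨ +-congʳ (trans (*-congʳ (∂-inv n)) (zeroˡ _)) ⟩
    0# + inv n * ∂ (∂! n (∂ a))                        ≈⟨ +-identityˡ _ ⟩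
    ∂! (suc n) (∂ a)                                   ∎)

  ∂^≈n!•∂! : ∀ n a → ∂^ n a ≈ (n !) • ∂! n a
  ∂^≈n!•∂! zero    a = sym (+-identityʳ _)
  ∂^≈n!•∂! (suc n) a = begin
    ∂ (∂^ n a)                        ≈⟨ ∂-cong (∂^≈n!•∂! n a) ⟩
    ∂ ((n !) • ∂! n a)                  ≈⟨ ∂-• (n !) _ ⟩
    (n !) • ∂ (∂! n a)                  ≈⟨ ×-congʳ (n !) (∂-∂! n a) ⟩
    (n !) • (suc n • ∂! (suc n) a)      ≈⟨ ×-assocˡ _ (n !) (suc n) ⟩
    (n ! ℕ.* suc n) • ∂! (suc n) a    ≡⟨ ≡.cong (_• ∂! (suc n) a) (ℕ.*-comm (n !) (suc n)) ⟩
    (suc n !) • ∂! (suc n) a          ∎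

-- Read as a grammar: a cycle of length k can absorb a new point in k places, and a new fixed point
-- costs a factor `b 1` and raises the number of cycles, which is the index of `g`.
record CycleWeights {c ℓ : Level} (K : DifferentialRing c ℓ) : Set (lsuc (c ⊔ ℓ)) where
  open DifferentialRing K
  field
    b g : ℕ → Carrier
    ∂-b : ∀ k → ∂ (b k) ≈ k • b (suc k)
    ∂-g : ∀ l → ∂ (g l) ≈ b 1 * g (suc l)

  monomial : List ℕ → Carrier
  monomial ks = ∏ ks b * g (length ks)

-- Set partitions

-- For the Leibniz rule, cycles matter only as classes of an equivalence. A list `ls` of pairwise
-- inequivalent representatives stands for the partition.
module Blocks {A : Set} {_~_ : Rel A 0ℓ} (isEquivalence : IsEquivalence _~_)
  (_~?_ : Decidable₂ _~_) (universe : List A) where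

  private module ~ = IsEquivalence isEquivalence

  size : A → ℕ
  size i = length (filter (i ~?_) universe)

  size-cong : ∀ {i j} → i ~ j → size i ≡ size j
  size-cong p = ≡.cong length (List.filter-≐ _ _ (~.trans (~.sym p) , ~.trans p) universe)

  Disjoint : List A → Set
  Disjoint = AllPairs (λ p q → ¬ (p ~ q))

  others : A → List A → List A
  others j = filter (λ p → ¬? (p ~? j))

  length-others : ∀ j {ls} → Disjoint ls → Any (_~ j) ls → suc (length (others j ls)) ≡ length ls
  length-others j {q ∷ ls} (q∌ ∷ _) _ with q ~? j
  ... | yes q~j = ≡.cong (suc ∘ length) (List.filter-all _ (All.map (λ q≁p p~j → q≁p (~.trans q~j (~.sym p~j))) q∌))
  length-others j (_ ∷ _) (here q~j)  | no q≁j = contradiction q~j q≁j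
  length-others j (_ ∷ d) (there any) | no _   = ≡.cong suc (length-others j d any)

  module Weight {c ℓ : Level} (K : DifferentialRing c ℓ) (W : CycleWeights K) where
    open DifferentialRing K
    open CycleWeights W
    open import Relation.Binary.Reasoning.Setoid setoid
    open import Algebra.Properties.CommutativeSemigroup *-commutativeSemigroup using (x∙yz≈y∙xz; x∙yz≈yx∙z)

    weight : List A → Carrier
    weight ls = ∏ ls (b ∘ size)

    -- The weight after the block of `j` has gained one point, and 0 if no listed block contains
    -- `j`. Each factor stays in its place, so that the product rule can be applied from the head of
    -- the list.
    grow : List A → A → Carrier
    grow []       j = 0#
    grow (q ∷ ls) j = if does (q ~? j) then b (suc (size q)) * weight ls else b (size q) * grow ls j

    grow-∉ : ∀ {j ls} → All (λ p → ¬ (p ~ j)) ls → grow ls j ≈ 0#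
    grow-∉ [] = refl
    grow-∉ {j} {q ∷ ls} (q≁j ∷ r) with q ~? j
    ... | yes q~j = contradiction q~j q≁j
    ... | no  _   = trans (*-congˡ (grow-∉ r)) (zeroʳ _)

    grow-∈ : ∀ j {ls} → Disjoint ls → Any (_~ j) ls → grow ls j ≈ b (suc (size j)) * weight (others j ls)
    grow-∈ j {q ∷ ls} (q∌ ∷ _) _ with q ~? j
    ... | yes q~j = reflexive (≡.cong₂ (λ k xs → b (suc k) * weight xs) (size-cong q~j)
                      (≡.sym (List.filter-all _ (All.map (λ q≁p p~j → q≁p (~.trans q~j (~.sym p~j))) q∌))))
    grow-∈ j (_ ∷ _) (here q~j)  | no q≁j = contradiction q~j q≁j
    grow-∈ j (_ ∷ d) (there any) | no _   = trans (*-congˡ (grow-∈ j d any)) (x∙yz≈y∙xz _ _ _)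

    -- The factor k in ∂bₖ = k·bₖ₊₁ is spread over the k points of the block, one summand for each;
    -- the product rule thereby becomes a sum over all points.
    ∂-weight : ∀ {ls} → Disjoint ls → ∂ (weight ls) ≈ ∑ universe (grow ls)
    ∂-weight []                       = trans ∂-1 (sym (∑-0 universe))
    ∂-weight {q ∷ ls} (q∌ ∷ disjoint) = begin
      ∂ (b (size q) * weight ls)
        ≈⟨ ∂-* _ _ ⟩
      ∂ (b (size q)) * weight ls + b (size q) * ∂ (weight ls)
        ≈⟨ +-cong (*-congʳ (∂-b (size q))) (*-congˡ (∂-weight disjoint)) ⟩
      size q • b (suc (size q)) * weight ls + b (size q) * ∑ universe (grow ls)
        ≈⟨ +-congʳ (×-assoc-* (size q) _ _) ⟩
      size q • (b (suc (size q)) * weight ls) + b (size q) * ∑ universe (grow ls)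
        ≈⟨ split universe ⟨
      ∑ universe (grow (q ∷ ls)) ∎
      where
      -- A point of the block of `q` yields one copy of the enlarged head, and `grow ls` vanishes on
      -- it because the blocks are disjoint. Any other point leaves the head alone and enlarges a
      -- block of `ls`.
      split : ∀ xs → ∑ xs (grow (q ∷ ls)) ≈
              length (filter (q ~?_) xs) • (b (suc (size q)) * weight ls) + b (size q) * ∑ xs (grow ls)
      split [] = sym (trans (+-identityˡ _) (zeroʳ _))
      split (j ∷ xs) with q ~? j
      ... | yes q~j = begin
        b (suc (size q)) * weight ls + ∑ xs (grow (q ∷ ls))
          ≈⟨ trans (+-congˡ (split xs)) (sym (+-assoc _ _ _)) ⟩
        _ + b (size q) * ∑ xs (grow ls)
          ≈⟨ +-congˡ (*-congˡ (trans (+-congʳ (grow-∉ (All.map (λ q≁p p~j → q≁p (~.trans q~j (~.sym p~j))) q∌)))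
                                     (+-identityˡ _))) ⟨
        _ + b (size q) * (grow ls j + ∑ xs (grow ls)) ∎
      ... | no _ = begin
        b (size q) * grow ls j + ∑ xs (grow (q ∷ ls))
          ≈⟨ +-congˡ (split xs) ⟩
        b (size q) * grow ls j + (_ + b (size q) * ∑ xs (grow ls))
          ≈⟨ x∙yz≈y∙xz+ _ _ _ ⟩
        _ + (b (size q) * grow ls j + b (size q) * ∑ xs (grow ls))
          ≈⟨ +-congˡ (distribˡ _ _ _) ⟨
        _ + b (size q) * (grow ls j + ∑ xs (grow ls)) ∎
        where open import Algebra.Properties.CommutativeSemigroup
                (CommutativeMonoid.commutativeSemigroup +-commutativeMonoid)
                using () renaming (x∙yz≈y∙xz to x∙yz≈y∙xz+)

    monomial-map : ∀ k ls → b k * weight ls * g (suc (length ls)) ≡ monomial (k ∷ map size ls)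
    monomial-map k ls = ≡.cong₂ (λ x m → b k * x * g (suc m)) (≡.sym (∏-map size ls b)) (≡.sym (List.length-map size ls))

    ∂-monomial : ∀ {ls} → Disjoint ls → (∀ j → Any (_~ j) ls) →
                 ∂ (monomial (map size ls)) ≈
                 monomial (1 ∷ map size ls) + ∑ universe (λ j → monomial (suc (size j) ∷ map size (others j ls)))
    ∂-monomial {ls} disjoint cover = begin
      ∂ (monomial (map size ls))
        ≡⟨ ≡.cong₂ (λ x m → ∂ (x * g m)) (∏-map size ls b) (List.length-map size ls) ⟩
      ∂ (weight ls * g (length ls))
        ≈⟨ ∂-* _ _ ⟩
      ∂ (weight ls) * g (length ls) + weight ls * ∂ (g (length ls))
        ≈⟨ +-comm _ _ ⟩
      weight ls * ∂ (g (length ls)) + ∂ (weight ls) * g (length ls)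
        ≈⟨ +-cong (*-congˡ (∂-g (length ls))) (*-congʳ (∂-weight disjoint)) ⟩
      weight ls * (b 1 * g (suc (length ls))) + ∑ universe (grow ls) * g (length ls)
        ≈⟨ +-cong (trans (x∙yz≈yx∙z _ _ _) (reflexive (monomial-map 1 ls)))
                  (trans (*-comm _ _) (trans (*-∑ _ universe _) (∑-cong universe grown))) ⟩
      monomial (1 ∷ map size ls) + ∑ universe (λ j → monomial (suc (size j) ∷ map size (others j ls))) ∎
      where
      grown : ∀ j → g (length ls) * grow ls j ≈ monomial (suc (size j) ∷ map size (others j ls))
      grown j = begin
        g (length ls) * grow ls j
          ≈⟨ trans (*-comm _ _) (*-congʳ (grow-∈ j disjoint (cover j))) ⟩
        b (suc (size j)) * weight (others j ls) * g (length ls)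
          ≡⟨ ≡.cong (λ m → b (suc (size j)) * weight (others j ls) * g m) (length-others j disjoint (cover j)) ⟨
        b (suc (size j)) * weight (others j ls) * g (suc (length (others j ls)))
          ≡⟨ monomial-map (suc (size j)) (others j ls) ⟩
        monomial (suc (size j) ∷ map size (others j ls)) ∎

-- Lagrange inversion and the Eulerian grammar

module Parametrisation {c ℓ : Level} (R : CommutativeRing c ℓ) (x : CommutativeRing.Carrier R)
  (inv : ℕ → CommutativeRing.Carrier R)
  (•-inv : ∀ n → CommutativeRing._≈_ R
    (Multiple._×_ (CommutativeRing.+-rawMonoid R) (suc n) (inv n)) (CommutativeRing.1# R)) where

  private module R where
    open CommutativeRing R public hiding (zero)
    open import Algebra.Properties.Semiring.Mult semiring public renaming (_×_ to infixr 8 _•_)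
    open import Algebra.Properties.Semiring.Exp semiring public using (_^_)
    open import Algebra.Properties.Group +-group public using (∙-cancelʳ)

  open PowerSeries R

  derivationD : DifferentialRing c ℓ
  derivationD = record
    { commutativeRing = seriesRing
    ; ∂ = D ; ∂-cong = D-cong ; ∂-+ = D-⊕ ; ∂-* = D-⊛ }

  open DifferentialRing derivationD
  open import Algebra.Properties.Semiring.Exp semiring using (_^_)
  open import Algebra.Properties.Group +-group using (∙-cancelʳ)
  open import Algebra.Solver.Ring.NaturalCoefficients.Default commutativeSemiring
    using (solve; _:=_; _:+_; _:*_; con)

  •-coeff : ∀ n f k → (n • f) k ≡ n R.• f k
  •-coeff zero    f k = ≡.refl
  •-coeff (suc n) f k = ≡.cong (f k R.+_) (•-coeff n f k)

  u X a d φ φ′ : Series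
  u = shift 1#
  X = const x
  d = const (R.1# R.+ R.- x)

  linear : R.Carrier → Series
  linear y = 1# + const y * u

  a = linear R.1#
  c′ = linear x
  φ = a * c′
  φ′ = c′ + X * a

  linear-0 : ∀ y → linear y 0 R.≈ R.1#
  linear-0 y = R.trans (R.+-congˡ (R.zeroʳ y)) (R.+-identityʳ _)

  u-* : ∀ f → u * f ≈ shift f
  u-* f k = R.trans (shift-⊛ 1# f k) (lemma k)
    where
    lemma : ∀ k → shift (1# ⊛ f) k R.≈ shift f k
    lemma zero    = R.refl
    lemma (suc k) = ⊛-identityˡ f k

  D-const : ∀ y → D (const y) ≈ 0#
  D-const y k = R.trans (R.×-congʳ (suc k) (R.sym (R.zeroˡ R.1#)))
    (R.trans (R.sym (R.×-assoc-* (suc k) R.0# R.1#)) (R.trans (R.*-congʳ (zero-• (suc k))) (R.zeroˡ _)))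
    where
    zero-• : ∀ n → n R.• R.0# R.≈ R.0#
    zero-• zero    = R.refl
    zero-• (suc n) = R.trans (R.+-identityˡ _) (zero-• n)

  D-u* : ∀ f k → D (u * f) k R.≈ suc k R.• f k
  D-u* f k = R.×-congʳ (suc k) (u-* f (suc k))

  D-u : D u ≈ 1#
  D-u zero    = R.+-identityʳ _
  D-u (suc k) = D-const R.0# (suc k)

  D-linear : ∀ y → D (linear y) ≈ const y
  D-linear y = begin
    D (1# + const y * u)                  ≈⟨ trans (D-⊕ 1# (const y * u)) (+-cong (D-const R.1#) (D-⊛ (const y) u)) ⟩
    0# + (D (const y) * u + const y * D u) ≈⟨ +-identityˡ _ ⟩
    D (const y) * u + const y * D u       ≈⟨ +-cong (trans (*-congʳ {u} (D-const y)) (zeroˡ u)) (*-congˡ {const y} D-u) ⟩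
    0# + const y * 1#                     ≈⟨ trans (+-identityˡ _) (*-identityʳ _) ⟩
    const y                               ∎
    where open import Relation.Binary.Reasoning.Setoid setoid

  D-φ : D φ ≈ φ′
  D-φ = trans (D-⊛ a c′) (+-cong (trans (*-congʳ {c′} (D-linear R.1#)) (*-identityˡ c′))
                                 (trans (*-congˡ {a} (D-linear x)) (*-comm a X)))

  -- The identity φ - uφ′ = 1 - xu², written without subtraction.
  φ-Euler : φ + X * (u * u) ≈ 1# + u * φ′
  φ-Euler = solve 2 (λ u X → let a = con 1 :+ con 1 :* u ; c′ = con 1 :+ X :* u in
    a :* c′ :+ X :* (u :* u) := con 1 :+ u :* (c′ :+ X :* a)) refl u X

  -- β = φ/(φ − uφ′) = φ/(1 − xu²)
  β : Series
  β zero          = φ 0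
  β (suc zero)    = φ 1
  β (suc (suc k)) = φ (suc (suc k)) R.+ x R.* β k

  β-eq : β ≈ φ + X * (u * u) * β
  β-eq k = R.sym (R.trans (R.+-congˡ (R.trans (⊛-cong (λ k → R.refl) (λ _ → R.refl) k) (coeff-XuuF k))) (split k))
    where
    coeff-XuuF : ∀ k → (X * (u * u) * β) k R.≈ x R.* shift (shift β) k
    coeff-XuuF k = R.trans (solve 3 (λ X u f → X :* (u :* u) :* f := X :* (u :* (u :* f))) refl X u β k)
      (R.trans (const-⊛ x (u * (u * β)) k) (R.*-congˡ (R.trans (*-congˡ {u} (u-* β) k) (u-* (shift β) k))))
    split : ∀ k → φ k R.+ x R.* shift (shift β) k R.≈ β k
    split zero          = R.trans (R.+-congˡ (R.zeroʳ x)) (R.+-identityʳ _)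
    split (suc zero)    = R.trans (R.+-congˡ (R.zeroʳ x)) (R.+-identityʳ _)
    split (suc (suc k)) = R.refl

  module T = DifferentialRing (scaleDerivation derivationD φ)
  K : DifferentialRing c ℓ
  K = scaleDerivation (scaleDerivation derivationD φ) β
  module K = DifferentialRing K

  ∂-const : ∀ y → K.∂ (const y) ≈ 0#
  ∂-const y = trans (*-congˡ {β} (trans (*-congˡ {φ} (D-const y)) (zeroʳ φ))) (zeroʳ β)

  •-const-inv : ∀ n → suc n • const (inv n) ≈ 1#
  •-const-inv n zero    = R.trans (R.reflexive (•-coeff (suc n) (const (inv n)) zero)) (•-inv n)
  •-const-inv n (suc k) = R.trans (R.reflexive (•-coeff (suc n) (const (inv n)) (suc k))) (D-const (inv n) n) 

  open DividedDerivative K (const ∘ inv) (∂-const ∘ inv) •-const-inv public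

  -- This is β(φ - uφ′) = φ multiplied by h. Once xu²βh is added on both sides, `φ-Euler` and `β-eq`
  -- apply, and the added term cancels.
  φβh : ∀ h → φ * (β * h) ≈ φ * h + u * (φ′ * (β * h))
  φβh h = ∙-cancelʳ (X * (u * u) * (β * h)) _ _ (begin
    φ * (β * h) + X * (u * u) * (β * h)
      ≈⟨ distribʳ (β * h) φ (X * (u * u)) ⟨
    (φ + X * (u * u)) * (β * h)
      ≈⟨ *-congʳ {β * h} φ-Euler ⟩
    (1# + u * φ′) * (β * h)
      ≈⟨ solve 4 (λ u φ′ β h → (con 1 :+ u :* φ′) :* (β :* h) := β :* h :+ u :* (φ′ :* (β :* h))) refl u φ′ β h ⟩
    β * h + u * (φ′ * (β * h))
      ≈⟨ +-congʳ (*-congʳ {h} β-eq) ⟩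
    (φ + X * (u * u) * β) * h + u * (φ′ * (β * h))
      ≈⟨ solve 5 (λ φ w β h v → (φ :+ w :* β) :* h :+ v := (φ :* h :+ v) :+ w :* (β :* h)) refl φ (X * (u * u)) β h _ ⟩
    (φ * h + u * (φ′ * (β * h))) + X * (u * u) * (β * h) ∎)
    where open import Relation.Binary.Reasoning.Setoid setoid

  -- Put f = βh and G = φⁿφ′f. By `φβh`, hφⁿ⁺¹ + uG = φⁿ⁺¹f, and the derivative of the right side is
  -- φⁿ⁺¹f′ + (n + 1)G. The coefficient of uⁿ in (uG)′ is n + 1 times that of G, so these two terms
  -- cancel in this one degree.
  D-hφ : ∀ h n → D (h * φ ^ suc n) n R.≈ (φ * D (β * h) * φ ^ n) n
  D-hφ h n = R.∙-cancelʳ (suc n R.• (φ ^ n * (φ′ * f)) n) _ _ (begin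
    D (h * φ ^ suc n) n R.+ suc n R.• (φ ^ n * (φ′ * f)) n
      ≈⟨ R.+-congˡ (D-u* (φ ^ n * (φ′ * f)) n) ⟨
    D (h * φ ^ suc n) n R.+ D (u * (φ ^ n * (φ′ * f))) n
      ≈⟨ D-⊕ (h * φ ^ suc n) (u * (φ ^ n * (φ′ * f))) n ⟨
    D (h * φ ^ suc n + u * (φ ^ n * (φ′ * f))) n
      ≈⟨ D-cong regroup n ⟩
    D (φ ^ suc n * f) n
      ≈⟨ D-⊛ (φ ^ suc n) f n ⟩
    (D (φ ^ suc n) * f) n R.+ (φ ^ suc n * D f) n
      ≈⟨ R.+-congʳ (trans (*-congʳ {f} (trans (∂-^ φ n) (×-congʳ (suc n) (*-congˡ {φ ^ n} D-φ))))
                          (trans (×-assoc-* (suc n) (φ ^ n * φ′) f) (×-congʳ (suc n) (*-assoc (φ ^ n) φ′ f))) n) ⟩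
    (suc n • (φ ^ n * (φ′ * f))) n R.+ (φ ^ suc n * D f) n
      ≡⟨ ≡.cong (R._+ (φ ^ suc n * D f) n) (•-coeff (suc n) (φ ^ n * (φ′ * f)) n) ⟩
    suc n R.• (φ ^ n * (φ′ * f)) n R.+ (φ ^ suc n * D f) n
      ≈⟨ R.+-comm _ _ ⟩
    (φ ^ suc n * D f) n R.+ suc n R.• (φ ^ n * (φ′ * f)) n
      ≈⟨ R.+-congʳ (solve 3 (λ φ p g → φ :* p :* g := φ :* g :* p) refl φ (φ ^ n) (D f) n) ⟩
    (φ * D f * φ ^ n) n R.+ suc n R.• (φ ^ n * (φ′ * f)) n ∎)
    where
    open import Relation.Binary.Reasoning.Setoid R.setoid
    f = β * h
    regroup : h * φ ^ suc n + u * (φ ^ n * (φ′ * f)) ≈ φ ^ suc n * f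
    regroup = trans (solve 5 (λ h φ p u w → h :* (φ :* p) :+ u :* (p :* w) := p :* (φ :* h :+ u :* w))
                       refl h φ (φ ^ n) u (φ′ * f))
              (trans (*-congˡ {φ ^ n} (sym (φβh h)))
                     (solve 3 (λ p φ f → p :* (φ :* f) := φ :* p :* f) refl (φ ^ n) φ f))

  -- Lagrange inversion in the form [yⁿ](βh) = [uⁿ](hφⁿ). The induction runs over all h at once:
  -- ∂(βh) = β·(φ·(βh)′) again has the form β times a series, and `D-hφ` compares the coefficients.
  lagrange : ∀ n h → ∂! n (β * h) 0 R.≈ (h * φ ^ n) n
  lagrange zero h = begin
    φ 0 R.* h 0  ≈⟨ R.*-congʳ φ-0 ⟩
    R.1# R.* h 0 ≈⟨ R.*-comm _ _ ⟩
    h 0 R.* R.1# ∎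
    where
    open import Relation.Binary.Reasoning.Setoid R.setoid
    φ-0 : φ 0 R.≈ R.1#
    φ-0 = R.trans (R.*-cong (linear-0 R.1#) (linear-0 x)) (R.*-identityˡ _)
  lagrange (suc n) h = begin
    ∂! (suc n) (β * h) 0                                ≈⟨ ∂!-suc n (β * h) 0 ⟩
    inv n R.* ∂! n (β * (φ * D (β * h))) 0              ≈⟨ R.*-congˡ (lagrange n (φ * D (β * h))) ⟩
    inv n R.* (φ * D (β * h) * φ ^ n) n                 ≈⟨ R.*-congˡ (D-hφ h n) ⟨
    inv n R.* (suc n R.• (h * φ ^ suc n) (suc n))       ≈⟨ R.×-comm-* (suc n) _ _ ⟩
    suc n R.• (inv n R.* (h * φ ^ suc n) (suc n))       ≈⟨ R.×-assoc-* (suc n) _ _ ⟨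
    (suc n R.• inv n) R.* (h * φ ^ suc n) (suc n)       ≈⟨ R.trans (R.*-congʳ (•-inv n)) (R.*-identityˡ _) ⟩
    (h * φ ^ suc n) (suc n)                             ∎
    where open import Relation.Binary.Reasoning.Setoid R.setoid

  b : ℕ → Series
  -- No cycle has length 0. The value 0 makes `∂-b` hold at k = 0 and agrees with the empty list
  -- `narayanaB zero`.
  b zero    = 0#
  b (suc k) = ∂! k β

  ∂-b : ∀ k → K.∂ (b k) ≈ k • b (suc k)
  ∂-b zero    = K.∂-0
  ∂-b (suc k) = ∂-∂! k β

  b-0 : ∀ k → b (suc k) 0 R.≈ (φ ^ k) k
  b-0 k = R.trans (∂!-cong k (sym (*-identityʳ β)) 0)
            (R.trans (lagrange k 1#) (*-identityˡ (φ ^ k) k))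

  g : ℕ → Series
  g zero    = a
  g (suc l) = T.∂ (g l)

  -- By construction ∂ = β·T, and `b 1` is β.
  ∂-g : ∀ l → K.∂ (g l) ≈ b 1 * g (suc l)
  ∂-g l = refl

  T-const : ∀ y → T.∂ (const y) ≈ 0#
  T-const y = trans (*-congˡ {φ} (D-const y)) (zeroʳ φ)

  T-a : T.∂ a ≈ φ
  T-a = trans (*-congˡ {φ} (D-linear R.1#)) (*-identityʳ φ)

  T-c : T.∂ c′ ≈ φ * X
  T-c = *-congˡ {φ} (D-linear x)

  weights : CycleWeights K
  weights = record { b = b ; g = g ; ∂-b = ∂-b ; ∂-g = ∂-g }

  -- The first derivative turns 1 + u into βφ, and `lagrange` with h = φ handles the remaining n.
  -- Hence the factor n! next to the exponent n + 1, whose quotient by (n + 1)! is the 1/(n + 1) of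
  -- the Narayana numbers.
  ∂^g-0 : ∀ n → K.∂^ (suc n) (g 0) 0 R.≈ (n !) R.• (φ ^ suc n) n
  ∂^g-0 n = begin
    K.∂^ (suc n) a 0           ≡⟨ ≡.cong-app (K.∂^-suc n a) 0 ⟩
    K.∂^ n (K.∂ a) 0           ≈⟨ K.∂^-cong n (*-congˡ {β} T-a) 0 ⟩
    K.∂^ n (β * φ) 0           ≈⟨ ∂^≈n!•∂! n (β * φ) 0 ⟩
    ((n !) • ∂! n (β * φ)) 0   ≡⟨ •-coeff (n !) (∂! n (β * φ)) 0 ⟩
    (n !) R.• ∂! n (β * φ) 0   ≈⟨ R.×-congʳ (n !) (lagrange n φ) ⟩
    (n !) R.• (φ ^ suc n) n    ∎
    where open import Relation.Binary.Reasoning.Setoid R.setoid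

  -- By T-shifted this is (T − (1 − x))ⁱ (g k), where T = φ·d/du.
  shifted : ℕ → ℕ → Series
  shifted zero    k = g k
  shifted (suc i) k = shifted i (suc k) + - (d * shifted i k)

  -- T commutes with multiplication by the constant 1 - x.
  T-shifted : ∀ i k → T.∂ (shifted i k) ≈ shifted i (suc k)
  T-shifted zero    k = refl
  T-shifted (suc i) k = begin
    T.∂ (shifted i (suc k) + - (d * shifted i k))
      ≈⟨ T.∂-+ (shifted i (suc k)) (- (d * shifted i k)) ⟩
    T.∂ (shifted i (suc k)) + T.∂ (- (d * shifted i k))
      ≈⟨ +-cong (T-shifted i (suc k)) T-neg ⟩
    shifted i (suc (suc k)) + - (d * shifted i (suc k)) ∎
    where
    open import Relation.Binary.Reasoning.Setoid setoid
    open import Algebra.Properties.AbelianGroup +-abelianGroup using (inverseˡ-unique)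
    T-d* : ∀ f → T.∂ (d * f) ≈ d * T.∂ f
    T-d* f = trans (T.∂-* d f) (trans (+-congʳ (trans (*-congʳ {f} (T-const (R.1# R.+ R.- x))) (zeroˡ f)))
                                      (+-identityˡ _))
    T-neg : T.∂ (- (d * shifted i k)) ≈ - (d * shifted i (suc k))
    T-neg = inverseˡ-unique _ _ (begin
      T.∂ (- (d * shifted i k)) + d * shifted i (suc k)
        ≈⟨ +-congˡ (trans (T-d* (shifted i k)) (*-congˡ {d} (T-shifted i k))) ⟨
      T.∂ (- (d * shifted i k)) + T.∂ (d * shifted i k)
        ≈⟨ T.∂-+ (- (d * shifted i k)) (d * shifted i k) ⟨
      T.∂ (- (d * shifted i k) + d * shifted i k)
        ≈⟨ T.∂-cong (-‿inverseˡ (d * shifted i k)) ⟩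
      T.∂ 0#
        ≈⟨ T.∂-0 ⟩
      0# ∎)

  d+x≈1 : (R.1# R.+ R.- x) R.+ x R.≈ R.1#
  d+x≈1 = R.trans (R.+-assoc _ _ _) (R.trans (R.+-congˡ (R.-‿inverseˡ x)) (R.+-identityʳ _))

  d+X≈1 : d + X ≈ 1#
  d+X≈1 zero    = d+x≈1
  d+X≈1 (suc k) = R.+-identityʳ _

  c≈ : c′ ≈ d + X * a
  c≈ = trans (+-congʳ (sym d+X≈1)) (solve 3 (λ d X u → (d :+ X) :+ X :* u := d :+ X :* (con 1 :+ con 1 :* u)) refl d X u)

  shifted-suc : ∀ i k → shifted (suc i) k + d * shifted i k ≈ shifted i (suc k)
  shifted-suc i k = trans (+-assoc (shifted i (suc k)) (- (d * shifted i k)) (d * shifted i k))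
    (trans (+-congˡ (-‿inverseˡ (d * shifted i k))) (+-identityʳ _))

  -- Put r = a/c′. Then T r = (c′ - x·a)·r = (1 - x)·r, so T - (1 - x) is T conjugated by r, and (T
  -- - (1 - x))ⁿ⁺¹ a = r·Tⁿ⁺¹ c′. Since c′ and x·a differ by the constant 1 - x, Tⁿ⁺¹ c′ = x·Tⁿ⁺¹ a.
  -- Multiplying by c′ clears the denominator, and the induction reaches the result without forming
  -- r.
  c-shifted : ∀ n → c′ * shifted (suc n) 0 ≈ X * (a * g (suc n))
  c-shifted zero = ∙-cancelʳ (d * (c′ * a)) _ _ (begin
    c′ * shifted 1 0 + d * (c′ * a)
      ≈⟨ solve 4 (λ c s d a → c :* s :+ d :* (c :* a) := c :* (s :+ d :* a)) refl c′ (shifted 1 0) d a ⟩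
    c′ * (shifted 1 0 + d * a)
      ≈⟨ *-congˡ {c′} (trans (shifted-suc 0 0) T-a) ⟩
    c′ * φ
      ≈⟨ *-congʳ {φ} c≈ ⟩
    (d + X * a) * φ
      ≈⟨ solve 4 (λ d X a c → (d :+ X :* a) :* (a :* c) := X :* (a :* (a :* c)) :+ d :* (c :* a)) refl d X a c′ ⟩
    X * (a * φ) + d * (c′ * a)
      ≈⟨ +-congʳ (*-congˡ {X} (*-congˡ {a} T-a)) ⟨
    X * (a * g 1) + d * (c′ * a) ∎)
    where
    open import Relation.Binary.Reasoning.Setoid setoid
  -- T is applied to the case n. The added `X * φ * v` is the summand T(c′)·v of the product rule;
  -- splitting c′ as (1 - x) + x·a produces what cancels against it and against `- (d * v)`.
  c-shifted (suc n) = ∙-cancelʳ (X * φ * v) _ _ (begin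
    c′ * (shifted (suc n) 1 + - (d * v)) + X * φ * v
      ≈⟨ +-congʳ (*-congˡ {c′} (+-congʳ (T-shifted (suc n) 0))) ⟨
    c′ * (T.∂ v + - (d * v)) + X * φ * v
      ≈⟨ solve 6 (λ c t m X a v → c :* (t :+ m) :+ X :* (a :* c) :* v := (a :* c :* X :* v :+ c :* t) :+ c :* m)
            refl c′ (T.∂ v) (- (d * v)) X a v ⟩
    (φ * X * v + c′ * T.∂ v) + c′ * - (d * v)
      ≈⟨ +-congʳ (+-congʳ (*-congʳ {v} T-c)) ⟨
    (T.∂ c′ * v + c′ * T.∂ v) + c′ * - (d * v)
      ≈⟨ +-congʳ (T.∂-* c′ v) ⟨
    T.∂ (c′ * v) + c′ * - (d * v)
      ≈⟨ +-congʳ (T.∂-cong (c-shifted n)) ⟩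
    T.∂ (X * (a * w)) + c′ * - (d * v)
      ≈⟨ +-congʳ (T-XaF w) ⟩
    X * (φ * w + a * T.∂ w) + c′ * - (d * v)
      ≈⟨ solve 6 (λ X a c w t m → X :* (a :* c :* w :+ a :* t) :+ c :* m := (X :* (a :* t) :+ c :* m) :+ c :* (X :* (a :* w)))
            refl X a c′ w (T.∂ w) (- (d * v)) ⟩
    (X * (a * T.∂ w) + c′ * - (d * v)) + c′ * (X * (a * w))
      ≈⟨ +-congˡ (*-congˡ {c′} (c-shifted n)) ⟨
    (X * (a * T.∂ w) + c′ * - (d * v)) + c′ * (c′ * v)
      ≈⟨ +-congˡ (*-congʳ {c′ * v} c≈) ⟩
    (X * (a * T.∂ w) + c′ * - (d * v)) + (d + X * a) * (c′ * v)
      ≈⟨ solve 7 (λ X a c t m d v → (X :* (a :* t) :+ c :* m) :+ (d :+ X :* a) :* (c :* v)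
                   := (X :* (a :* t) :+ X :* (a :* c) :* v) :+ c :* (m :+ d :* v)) refl X a c′ (T.∂ w) (- (d * v)) d v ⟩
    (X * (a * T.∂ w) + X * φ * v) + c′ * (- (d * v) + d * v)
      ≈⟨ +-congˡ (trans (*-congˡ {c′} (-‿inverseˡ (d * v))) (zeroʳ c′)) ⟩
    (X * (a * T.∂ w) + X * φ * v) + 0#
      ≈⟨ +-identityʳ _ ⟩
    X * (a * g (suc (suc n))) + X * φ * v ∎)
    where
    open import Relation.Binary.Reasoning.Setoid setoid
    v = shifted (suc n) 0
    w = g (suc n)
    T-XaF : ∀ f → T.∂ (X * (a * f)) ≈ X * (φ * f + a * T.∂ f)
    T-XaF f = begin
      T.∂ (X * (a * f))                             ≈⟨ T.∂-* X (a * f) ⟩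
      T.∂ X * (a * f) + X * T.∂ (a * f)             ≈⟨ +-congʳ (trans (*-congʳ {a * f} (T-const x)) (zeroˡ (a * f))) ⟩
      0# + X * T.∂ (a * f)                          ≈⟨ +-identityˡ _ ⟩
      X * T.∂ (a * f)                               ≈⟨ *-congˡ {X} (trans (T.∂-* a f) (+-congʳ (*-congʳ {f} T-a))) ⟩
      X * (φ * f + a * T.∂ f)                       ∎

  ε : ℕ → ℕ → R.Carrier
  ε i k = shifted i k 0

  ε-00 : ε 0 0 R.≈ R.1#
  ε-00 = linear-0 R.1#

  ε-suc : ∀ i k → ε (suc i) k R.+ (R.1# R.+ R.- x) R.* ε i k R.≈ ε i (suc k)
  ε-suc i k = shifted-suc i k 0

  -- At u = 0 both linear factors in `c-shifted` are 1. In terms of permutations, a largest first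
  -- letter adds one descent and a smallest one adds none.
  ε-last : ∀ n → ε (suc n) 0 R.≈ x R.* ε 0 (suc n)
  ε-last n = begin
    ε (suc n) 0                        ≈⟨ R.*-identityˡ _ ⟨
    R.1# R.* ε (suc n) 0               ≈⟨ R.*-congʳ (linear-0 x) ⟨
    c′ 0 R.* ε (suc n) 0               ≈⟨ c-shifted n 0 ⟩
    x R.* (a 0 R.* ε 0 (suc n))        ≈⟨ R.*-congˡ (R.trans (R.*-congʳ (linear-0 R.1#)) (R.*-identityˡ _)) ⟩
    x R.* ε 0 (suc n)                  ∎
    where open import Relation.Binary.Reasoning.Setoid R.setoid

  linear-* : ∀ y f k → (linear y * f) (suc k) R.≈ f (suc k) R.+ y R.* f k
  linear-* y f k = R.trans (distribʳ f 1# (const y * u) (suc k))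
    (R.+-cong (*-identityˡ f (suc k)) (R.trans (*-assoc (const y) u f (suc k))
      (R.trans (const-⊛ y (u * f) (suc k)) (R.*-congˡ (u-* f (suc k))))))

  linear-^ : ∀ y n k → (linear y ^ n) k R.≈ (n C k) R.• y R.^ k
  linear-^ y zero    zero    = R.sym (R.+-identityʳ _)
  linear-^ y zero    (suc k) = R.reflexive (≡.sym (≡.cong (R._• y R.^ suc k) (k>n⇒nCk≡0 {0} {suc k} (ℕ.s≤s ℕ.z≤n))))
  linear-^ y (suc n) zero    = begin
    linear y 0 R.* (linear y ^ n) 0    ≈⟨ R.*-cong (linear-0 y) (linear-^ y n 0) ⟩
    R.1# R.* ((n C 0) R.• R.1#)        ≈⟨ R.*-identityˡ _ ⟩
    (n C 0) R.• R.1#                   ≡⟨ ≡.cong (R._• R.1#) (≡.trans (nC0≡1 n) (≡.sym (nC0≡1 (suc n)))) ⟩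
    (suc n C 0) R.• R.1#               ∎
    where
    open import Relation.Binary.Reasoning.Setoid R.setoid
    nC0≡1 : ∀ n → n C 0 ≡ 1
    nC0≡1 n = ≡.trans (nCk≡nC[n∸k] {0} {n} ℕ.z≤n) (nCn≡1 n)
  linear-^ y (suc n) (suc k) = begin
    (linear y * linear y ^ n) (suc k)
      ≈⟨ linear-* y (linear y ^ n) k ⟩
    (linear y ^ n) (suc k) R.+ y R.* (linear y ^ n) k
      ≈⟨ R.+-cong (linear-^ y n (suc k)) (R.*-congˡ (linear-^ y n k)) ⟩
    (n C suc k) R.• y R.^ suc k R.+ y R.* ((n C k) R.• y R.^ k)
      ≈⟨ R.trans (R.+-congˡ (R.×-comm-* (n C k) y (y R.^ k))) (R.+-comm _ _) ⟩
    (n C k) R.• y R.^ suc k R.+ (n C suc k) R.• y R.^ suc k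
      ≈⟨ R.×-homo-+ (y R.^ suc k) (n C k) (n C suc k) ⟨
    (n C k ℕ.+ n C suc k) R.• y R.^ suc k
      ≡⟨ ≡.cong (R._• y R.^ suc k) (nCk+nC[k+1]≡[n+1]C[k+1] n k) ⟩
    (suc n C suc k) R.• y R.^ suc k ∎
    where open import Relation.Binary.Reasoning.Setoid R.setoid

open import Data.Fin.Base using (zero; suc)
open ≡ using (refl; sym; trans; cong; cong₂; subst; subst₂)

-- Cycles of permutations

module Reindex {c ℓ : Level} (R : CommutativeRing c ℓ) (S : Setoid 0ℓ 0ℓ) where
  open CommutativeRing R using (Carrier; _≈_; _+_)
  private module R = CommutativeRing R
  open Sum R
  open Setoid S using () renaming (Carrier to A; _≈_ to _≋_)
  private module S = Setoid S
  open Membership S using () renaming (_∈_ to _∈ₛ_)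
  open import Algebra.Properties.CommutativeSemigroup (CommutativeMonoid.commutativeSemigroup R.+-commutativeMonoid)
    using (x∙yz≈y∙xz)

  ∑-─ : ∀ {f} → (∀ {x y} → x ≋ y → f x ≈ f y) → ∀ {x ys} (x∈ys : x ∈ₛ ys) → ∑ ys f ≈ f x + ∑ (ys ─ x∈ys) f
  ∑-─ f-cong (here x≋y)   = R.+-congʳ (f-cong (S.sym x≋y))
  ∑-─ f-cong (there x∈ys) = R.trans (R.+-congˡ (∑-─ f-cong x∈ys)) (x∙yz≈y∙xz _ _ _)

  ∈-─ : ∀ {x z ys} (x∈ys : x ∈ₛ ys) → ¬ (x ≋ z) → z ∈ₛ ys → z ∈ₛ (ys ─ x∈ys)
  ∈-─ (here x≋y)   x≉z (here z≋y)   = contradiction (S.trans x≋y (S.sym z≋y)) x≉z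
  ∈-─ (here x≋y)   x≉z (there z∈ys) = z∈ys
  ∈-─ (there x∈ys) x≉z (here z≋y)   = here z≋y
  ∈-─ (there x∈ys) x≉z (there z∈ys) = there (∈-─ x∈ys x≉z z∈ys)

  -- Each entry of `xs` is struck out of `ys`. As `xs` has no repetitions, the later entries survive
  -- this, and by equal length nothing is left at the end.
  ∑-reindex : ∀ {f} → (∀ {x y} → x ≋ y → f x ≈ f y) → ∀ {xs ys} → Unique S xs →
              All (_∈ₛ ys) xs → length xs ≡ length ys → ∑ xs f ≈ ∑ ys f
  ∑-reindex f-cong {[]}     {[]}    _             _             _   = R.refl
  ∑-reindex f-cong {x ∷ xs} {ys} (x∉xs ∷ unique) (x∈ys ∷ xs⊆ys) len =
    R.trans (R.+-congˡ (∑-reindex f-cong unique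
        (All.zipWith (λ (x≉z , z∈ys) → ∈-─ x∈ys x≉z z∈ys) (x∉xs , xs⊆ys))
        (ℕ.suc-injective (trans len (List.length-removeAt′ ys (index x∈ys))))))
      (R.sym (∑-─ f-cong x∈ys))

-- attach (suc j) ρ puts 0 into the cycle of suc j, just before suc j; attach zero ρ makes 0 a fixed point.
attach : ∀ {n} → Fin (suc n) → Permutation′ n → Permutation′ (suc n)
attach i ρ = lift₀ ρ Perm.∘ₚ transpose zero i

-- A second enumeration of 𝔖ₙ₊₁, in which passing from 𝔖ₙ changes only one cycle or adds a fixed
-- point. The insertion used in `permutations` relabels images and gives no such control over
-- cycles.
attached : ∀ n → List (Permutation′ (suc n))
attached n = cartesianProductWith attach (allFin (suc n)) (permutations n)

attach-cong : ∀ {n} {i j : Fin (suc n)} {ρ σ : Permutation′ n} → i ≡ j → ρ Perm.≈ σ → attach i ρ Perm.≈ attach j σ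
attach-cong {i = i} {ρ = ρ} {σ} refl e k = cong (transpose zero i ⟨$⟩ʳ_) (Perm.lift₀-cong ρ σ e k)

-- Following π by the transposition of 0 and π(0) gives a permutation that fixes 0; restricted to
-- the other points it is the required ρ, and i = π(0).
attached-complete : ∀ {n} (π : Permutation′ (suc n)) → Membership._∈_ (permSetoid (suc n)) π (attached n)
attached-complete {n} π =
  Membershipₚ.∈-resp-≈ (permSetoid (suc n)) {x = attach i (remove zero σ)} {y = π} attach-remove
    (Membershipₚ.∈-cartesianProductWith⁺ (≡.setoid (Fin (suc n))) (permSetoid n) (permSetoid (suc n))
      (λ {i} {j} {ρ} {σ} → attach-cong {i = i} {j} {ρ} {σ})
      (∈-allFin i) (permutations-complete n (remove zero σ)))
  where
  i = π ⟨$⟩ʳ zero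
  σ = π Perm.∘ₚ transpose i zero
  σ-zero : σ ⟨$⟩ʳ zero ≡ zero
  σ-zero with i Fin.≟ i
  ... | yes _  = refl
  ... | no i≢i = contradiction refl i≢i
  attach-remove : attach i (remove zero σ) Perm.≈ π
  attach-remove k = trans (cong (transpose zero i ⟨$⟩ʳ_) (Perm.lift₀-remove σ σ-zero k))
                          (Perm.inverseˡ (transpose i zero))

-- Serves to compare `permutations (suc n)` with `attached n`, which combine the same two lists by
-- different functions.
length-cartesianProductWith-cong : ∀ {A B C D : Set} (f : A → B → C) (g : A → B → D) xs ys →
  length (cartesianProductWith f xs ys) ≡ length (cartesianProductWith g xs ys)
length-cartesianProductWith-cong f g []       ys = refl
length-cartesianProductWith-cong f g (x ∷ xs) ys = begin
  length (map (f x) ys ++ _)   ≡⟨ List.length-++ (map (f x) ys) ⟩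
  length (map (f x) ys) ℕ.+ _  ≡⟨ cong₂ ℕ._+_ (trans (List.length-map (f x) ys) (sym (List.length-map (g x) ys)))
                                    (length-cartesianProductWith-cong f g xs ys) ⟩
  length (map (g x) ys) ℕ.+ _  ≡⟨ List.length-++ (map (g x) ys) ⟨
  length (map (g x) ys ++ _)   ∎
  where open ≡.≡-Reasoning

module _ {c ℓ : Level} (R : CommutativeRing c ℓ) (n : ℕ) where
  open CommutativeRing R using (Carrier; _≈_)
  open Sum R
  open Reindex R (permSetoid (suc n))

  ∑-attach : {f : Permutation′ (suc n) → Carrier} → (∀ {π ρ} → π Perm.≈ ρ → f π ≈ f ρ) →
             ∑ (permutations (suc n)) f ≈ ∑ (allFin (suc n)) (λ i → ∑ (permutations n) (λ ρ → f (attach i ρ)))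
  ∑-attach {f} f-cong = CommutativeRing.trans R
    (∑-reindex (λ {π} {ρ} → f-cong {π} {ρ}) (permutations-unique (suc n)) (All.universal attached-complete _)
      (length-cartesianProductWith-cong (insert zero) attach (allFin (suc n)) (permutations n)))
    (∑-cartesianProductWith attach (allFin (suc n)) (permutations n) f)

module Cycles {n : ℕ} (w : Permutation′ n) where

  sameCycle-trans : ∀ {i j k} → SameCycle w i j → SameCycle w j k → SameCycle w i k
  sameCycle-trans (a , refl) (b , refl) = a ℕ.+ b , power-+ w a b _

  sameCycle-sym : ∀ {i j} → SameCycle w i j → SameCycle w j i
  sameCycle-sym {i} (k , refl) with period w i
  -- With d a period of i, another k·d - k steps complete k full periods; k ≤ k·d because d is
  -- nonzero.
  ... | d , d≢0 , _ , e = k ℕ.* d ℕ.∸ k , (begin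
    power w (k ℕ.* d ℕ.∸ k) (power w k i)  ≡⟨ power-+ w k _ i ⟨
    power w (k ℕ.+ (k ℕ.* d ℕ.∸ k)) i      ≡⟨ cong (λ m → power w m i) (ℕ.m+[n∸m]≡n (ℕ.m≤m*n k d {{d≢0}})) ⟩
    power w (k ℕ.* d) i                    ≡⟨ power-* w e k ⟩
    i                                      ∎)
    where open ≡.≡-Reasoning

  sameCycle-isEquivalence : IsEquivalence (SameCycle w)
  sameCycle-isEquivalence = record
    { refl = 0 , refl ; sym = sameCycle-sym ; trans = sameCycle-trans }

  open Blocks sameCycle-isEquivalence (sameCycle? w) (allFin n) public

  leaders : List (Fin n)
  leaders = filter (isLeader? w) (allFin n)

  leaders-disjoint : Disjoint leaders
  leaders-disjoint = strengthen (unique-filter (isLeader? w) (allFin⁺ n)) (All.all-filter (isLeader? w) (allFin n))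
    where
    strengthen : ∀ {is} → AllPairs _≢_ is → All (IsLeader w) is → Disjoint is
    strengthen []       []       = []
    strengthen (p ∷ ps) (l ∷ ls) =
      All.zipWith (λ (i≢j , l′) i~j → i≢j (Fin.≤-antisym (l _ i~j) (l′ _ (sameCycle-sym i~j)))) (p , ls)
      ∷ strengthen ps ls

  -- A point that is not least in its cycle has a smaller one in the same cycle; this descent ends
  -- at a leader.
  leaders-cover : ∀ j → Any (λ i → SameCycle w i j) leaders
  leaders-cover j with leader j (Fin.<-wellFounded j)
    where
    leader : ∀ j → Acc Fin._<_ j → ∃ λ i → IsLeader w i × SameCycle w i j
    leader j (acc rec) with isLeader? w j
    ... | yes l = j , l , 0 , refl
    ... | no ¬l with Fin.¬∀⟶∃¬ n _ (λ k → sameCycle? w j k →-dec (j Fin.≤? k)) ¬l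
    ...   | k , ¬jk with sameCycle? w j k
    ...     | no  j≁k = contradiction (λ j~k → contradiction j~k j≁k) ¬jk
    ...     | yes j~k with leader k (rec (ℕ.≰⇒> (λ j≤k → ¬jk (λ _ → j≤k))))
    ...       | i , l , i~k = i , l , sameCycle-trans i~k (sameCycle-sym j~k)
  ... | i , l , i~j = lose (∈-filter⁺ (isLeader? w) (∈-allFin i) l) i~j

open Cycles

filter-×-dec : {A : Set} {P Q : A → Set} (P? : Decidable P) (Q? : Decidable Q) → ∀ xs →
               filter (λ x → P? x ×-dec Q? x) xs ≡ filter Q? (filter P? xs)
filter-×-dec P? Q? []       = refl
filter-×-dec P? Q? (x ∷ xs) with P? x
... | no  _ = filter-×-dec P? Q? xs
... | yes _ with Q? x
...   | yes _ = cong (x ∷_) (filter-×-dec P? Q? xs)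
...   | no  _ = filter-×-dec P? Q? xs

tabulate-filter : ∀ {n} {P : Fin (suc n) → Set} (P? : Decidable P) →
                  filter P? (tabulate suc) ≡ map suc (filter (P? ∘ suc) (allFin n))
tabulate-filter {n} P? = trans (cong (filter P?) (sym (List.map-tabulate (λ k → k) suc))) (filter-map (allFin n))
  where
  filter-map : ∀ ks → filter P? (map suc ks) ≡ map suc (filter (P? ∘ suc) ks)
  filter-map []       = refl
  filter-map (k ∷ ks) with P? (suc k)
  ... | yes _ = cong (suc k ∷_) (filter-map ks)
  ... | no  _ = filter-map ks

module _ {n : ℕ} {P : Fin (suc n) → Set} (P? : Decidable P) where

  count-accept : P zero → count P? ≡ suc (count (P? ∘ suc))
  count-accept p = trans (cong length (List.filter-accept P? p))
    (cong suc (trans (cong length (tabulate-filter P?)) (List.length-map suc (filter (P? ∘ suc) (allFin n)))))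

  count-reject : ¬ P zero → count P? ≡ count (P? ∘ suc)
  count-reject ¬p = trans (cong length (List.filter-reject P? ¬p))
    (trans (cong length (tabulate-filter P?)) (List.length-map suc (filter (P? ∘ suc) (allFin n))))

count-cong : ∀ {n} {P Q : Fin n → Set} (P? : Decidable P) (Q? : Decidable Q) → P ≐ Q → count P? ≡ count Q?
count-cong P? Q? P≐Q = cong length (List.filter-≐ P? Q? P≐Q (allFin _))

-- The point 0 is always the least of its cycle, so its cycle heads the list, and only leaders of
-- the form `suc p` remain to be matched.
cycleType-suc : ∀ {n} (w : Permutation′ (suc n)) {P : Fin n → Set} (P? : Decidable P) (s : Fin n → ℕ) →
                (λ p → IsLeader w (suc p)) ≐ P → (∀ {p} → P p → count (sameCycle? w (suc p)) ≡ s p) →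
                cycleType w ≡ count (sameCycle? w zero) ∷ map s (filter P? (allFin n))
cycleType-suc {n} w P? s leader⇔P size≡s = begin
  cycleType w
    ≡⟨ cong (map size-w) (List.filter-accept (isLeader? w) {xs = tabulate suc} (λ _ _ → ℕ.z≤n)) ⟩
  size-w zero ∷ map size-w (filter (isLeader? w) (tabulate suc))
    ≡⟨ cong (λ is → size-w zero ∷ map size-w is) (tabulate-filter (isLeader? w)) ⟩
  size-w zero ∷ map size-w (map suc (filter (isLeader? w ∘ suc) (allFin n)))
    ≡⟨ cong (size-w zero ∷_) (List.map-∘ (filter (isLeader? w ∘ suc) (allFin n))) ⟨
  size-w zero ∷ map (size-w ∘ suc) (filter (isLeader? w ∘ suc) (allFin n))
    ≡⟨ cong (λ is → size-w zero ∷ map (size-w ∘ suc) is) (List.filter-≐ _ P? leader⇔P (allFin n)) ⟩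
  size-w zero ∷ map (size-w ∘ suc) (filter P? (allFin n))
    ≡⟨ cong (size-w zero ∷_) (List.map-cong-local (All.map size≡s (All.all-filter P? (allFin n)))) ⟩
  size-w zero ∷ map s (filter P? (allFin n)) ∎
  where
  open ≡.≡-Reasoning
  size-w : Fin (suc n) → ℕ
  size-w i = count (sameCycle? w i)

module AttachFixed {n : ℕ} (ρ : Permutation′ n) where

  power-zero : ∀ k → power (attach zero ρ) k zero ≡ zero
  power-zero zero    = refl
  power-zero (suc k) = power-zero k

  power-suc : ∀ k p → power (attach zero ρ) k (suc p) ≡ suc (power ρ k p)
  power-suc zero    p = refl
  power-suc (suc k) p = power-suc k (ρ ⟨$⟩ʳ p)

  zero≁suc : ∀ {q} → ¬ SameCycle (attach zero ρ) zero (suc q)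
  zero≁suc (k , e) with trans (sym e) (power-zero k)
  ... | ()

  suc≁zero : ∀ {p} → ¬ SameCycle (attach zero ρ) (suc p) zero
  suc≁zero {p} (k , e) with trans (sym e) (power-suc k p)
  ... | ()

  sameCycle-suc : ∀ {p} → (λ q → SameCycle (attach zero ρ) (suc p) (suc q)) ≐ SameCycle ρ p
  sameCycle-suc {p} = (λ (k , e) → k , Fin.suc-injective (trans (sym (power-suc k p)) e))
                    , (λ (k , e) → k , trans (power-suc k p) (cong suc e))

  leader-suc : (λ p → IsLeader (attach zero ρ) (suc p)) ≐ IsLeader ρ
  leader-suc = (λ l q p~q → ℕ.s≤s⁻¹ (l (suc q) (proj₂ sameCycle-suc p~q)))
             , λ { l zero    p~0 → contradiction p~0 suc≁zero
                 ; l (suc q) p~q → ℕ.s≤s (l q (proj₁ sameCycle-suc p~q)) }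

  cycleType-attach : cycleType (attach zero ρ) ≡ 1 ∷ cycleType ρ
  cycleType-attach = trans
    (cycleType-suc (attach zero ρ) (isLeader? ρ) (size ρ) leader-suc λ {p} _ →
      trans (count-reject (sameCycle? (attach zero ρ) (suc p)) suc≁zero)
            (count-cong (sameCycle? (attach zero ρ) (suc p) ∘ suc) (sameCycle? ρ p) sameCycle-suc))
    (cong (_∷ cycleType ρ) (trans (count-accept (sameCycle? (attach zero ρ) zero) (0 , refl))
      (cong suc (cong length (List.filter-none (sameCycle? (attach zero ρ) zero ∘ suc)
        (All.universal (λ _ → zero≁suc) (allFin n)))))))

module AttachBefore {n : ℕ} (ρ : Permutation′ n) (j : Fin n) where

  -- Identifies the new point 0 with `j`. A step of `attach (suc j) ρ` then becomes one step of ρ or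
  -- none, so equivalent points stay equivalent.
  contract : Fin (suc n) → Fin n
  contract zero    = j
  contract (suc k) = k

  contract-step : ∀ u → SameCycle ρ (contract u) (contract (attach (suc j) ρ ⟨$⟩ʳ u))
  contract-step zero    = 0 , refl
  contract-step (suc k) with (ρ ⟨$⟩ʳ k) Fin.≟ j
  ... | yes ρk≡j = 1 , ρk≡j
  ... | no  _    = 1 , refl

  sameCycle-contract : ∀ {u v} → SameCycle (attach (suc j) ρ) u v → SameCycle ρ (contract u) (contract v)
  sameCycle-contract {u} (zero  , refl) = 0 , refl
  sameCycle-contract {u} (suc k , e)    = sameCycle-trans ρ (contract-step u) (sameCycle-contract (k , e))

  attach-≡ : ∀ {k} → ρ ⟨$⟩ʳ k ≡ j → attach (suc j) ρ ⟨$⟩ʳ suc k ≡ zero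
  attach-≡ {k} ρk≡j with (ρ ⟨$⟩ʳ k) Fin.≟ j
  ... | yes _    = refl
  ... | no ρk≢j  = contradiction ρk≡j ρk≢j

  attach-≢ : ∀ {k} → ρ ⟨$⟩ʳ k ≢ j → attach (suc j) ρ ⟨$⟩ʳ suc k ≡ suc (ρ ⟨$⟩ʳ k)
  attach-≢ {k} ρk≢j with (ρ ⟨$⟩ʳ k) Fin.≟ j
  ... | yes ρk≡j = contradiction ρk≡j ρk≢j
  ... | no _     = refl

  -- Where ρ enters `j`, the extended permutation makes a detour through 0 and takes two steps.
  expand-step : ∀ k → SameCycle (attach (suc j) ρ) (suc k) (suc (ρ ⟨$⟩ʳ k))
  expand-step k with (ρ ⟨$⟩ʳ k) Fin.≟ j
  ... | yes ρk≡j = 2 , trans (cong (attach (suc j) ρ ⟨$⟩ʳ_) (attach-≡ ρk≡j)) (cong suc (sym ρk≡j))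
  ... | no  ρk≢j = 1 , attach-≢ ρk≢j

  sameCycle-expand : ∀ {p q} → SameCycle ρ p q → SameCycle (attach (suc j) ρ) (suc p) (suc q)
  sameCycle-expand         (zero  , refl) = 0 , refl
  sameCycle-expand {p} {q} (suc k , e)    = sameCycle-trans (attach (suc j) ρ) (expand-step p) (sameCycle-expand (k , e))

  zero~j : SameCycle (attach (suc j) ρ) zero (suc j)
  zero~j = 1 , refl

  suc~zero : ∀ {p} → SameCycle ρ p j → SameCycle (attach (suc j) ρ) (suc p) zero
  suc~zero p~j = sameCycle-trans (attach (suc j) ρ) (sameCycle-expand p~j) (sameCycle-sym (attach (suc j) ρ) zero~j)

  -- In the cycle of `j` the new point 0 takes over as least element, so exactly that leader of ρ is
  -- lost. This is why the enlarged cycle moves to the front and `others` removes its old entry.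
  leader-suc : (λ p → IsLeader (attach (suc j) ρ) (suc p)) ≐ (λ p → IsLeader ρ p × ¬ SameCycle ρ p j)
  leader-suc = (λ {p} l → (λ q p~q → ℕ.s≤s⁻¹ (l (suc q) (sameCycle-expand p~q)))
                        , λ p~j → contradiction (l zero (suc~zero p~j)) λ ())
             , λ { (l , p≁j) zero    p~0 → contradiction (sameCycle-contract p~0) p≁j
                 ; (l , p≁j) (suc q) p~q → ℕ.s≤s (l q (sameCycle-contract p~q)) }

  sameCycle-suc : ∀ {p} → (λ q → SameCycle (attach (suc j) ρ) (suc p) (suc q)) ≐ SameCycle ρ p
  sameCycle-suc = sameCycle-contract , sameCycle-expand

  private
    joinsLeader? : Decidable (λ p → IsLeader ρ p × ¬ SameCycle ρ p j)
    joinsLeader? p = isLeader? ρ p ×-dec ¬? (sameCycle? ρ p j)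

    others-leaders : filter joinsLeader? (allFin n) ≡ others ρ j (leaders ρ)
    others-leaders = filter-×-dec (isLeader? ρ) (λ p → ¬? (sameCycle? ρ p j)) (allFin n)

  cycleType-attach : cycleType (attach (suc j) ρ) ≡ suc (size ρ j) ∷ map (size ρ) (others ρ j (leaders ρ))
  cycleType-attach = trans
    (cycleType-suc (attach (suc j) ρ) joinsLeader? (size ρ) leader-suc λ {p} (_ , p≁j) →
      trans (count-reject (sameCycle? (attach (suc j) ρ) (suc p)) (p≁j ∘ sameCycle-contract))
            (count-cong (sameCycle? (attach (suc j) ρ) (suc p) ∘ suc) (sameCycle? ρ p) sameCycle-suc))
    (≡.cong₂ (λ k is → k ∷ map (size ρ) is)
      (trans (count-accept (sameCycle? (attach (suc j) ρ) zero) (0 , refl))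
        (cong suc (count-cong (sameCycle? (attach (suc j) ρ) zero ∘ suc) (sameCycle? ρ j)
          (sameCycle-contract , λ j~q → sameCycle-trans (attach (suc j) ρ) zero~j (sameCycle-expand j~q)))))
      others-leaders)

power-cong : ∀ {n} {v w : Permutation′ n} → v Perm.≈ w → ∀ k i → power v k i ≡ power w k i
power-cong         e zero    i = refl
power-cong {v = v} {w} e (suc k) i = trans (cong (power v k) (e i)) (power-cong {v = v} {w} e k _)

cycleType-cong : ∀ {n} {v w : Permutation′ n} → v Perm.≈ w → cycleType v ≡ cycleType w
cycleType-cong {n} {v} {w} e = trans
  (List.map-cong (λ i → count-cong (sameCycle? v i) (sameCycle? w i) (v⇒w , w⇒v)) (filter (isLeader? v) (allFin n)))
  (cong (map _) (List.filter-≐ _ _ ((λ l j i~j → l j (w⇒v i~j)) , (λ l j i~j → l j (v⇒w i~j))) (allFin n)))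
  where
  v⇒w : ∀ {i j} → SameCycle v i j → SameCycle w i j
  v⇒w (k , p) = k , trans (sym (power-cong {v = v} {w} e k _)) p
  w⇒v : ∀ {i j} → SameCycle w i j → SameCycle v i j
  w⇒v (k , p) = k , trans (power-cong {v = v} {w} e k _) p

module CycleExpansion {c ℓ : Level} (K : DifferentialRing c ℓ) (W : CycleWeights K) where
  open DifferentialRing K renaming (refl to ≈-refl; sym to ≈-sym; trans to ≈-trans)
  open CycleWeights W
  open import Relation.Binary.Reasoning.Setoid setoid

  monomial-cong : ∀ {ks ls} → ks ≡ ls → monomial ks ≈ monomial ls
  monomial-cong refl = ≈-refl

  ∂-monomial-cycleType : ∀ {n} (ρ : Permutation′ n) →
    ∂ (monomial (cycleType ρ)) ≈ ∑ (allFin (suc n)) (λ i → monomial (cycleType (attach i ρ)))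
  ∂-monomial-cycleType {n} ρ = begin
    ∂ (monomial (cycleType ρ))
      ≈⟨ Weight.∂-monomial ρ K W (leaders-disjoint ρ) (leaders-cover ρ) ⟩
    monomial (1 ∷ cycleType ρ) + ∑ (allFin n) (λ j → monomial (suc (size ρ j) ∷ map (size ρ) (others ρ j (leaders ρ))))
      ≈⟨ +-cong (monomial-cong {cycleType (attach zero ρ)} {1 ∷ cycleType ρ} (AttachFixed.cycleType-attach ρ))
                (∑-cong (allFin n) (λ j → monomial-cong
                  {cycleType (attach (suc j) ρ)} {suc (size ρ j) ∷ map (size ρ) (others ρ j (leaders ρ))}
                  (AttachBefore.cycleType-attach ρ j))) ⟨
    monomial (cycleType (attach zero ρ)) + ∑ (allFin n) (λ j → monomial (cycleType (attach (suc j) ρ)))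
      ≈⟨ ∑-allFin-suc (λ i → monomial (cycleType (attach i ρ))) ⟨
    ∑ (allFin (suc n)) (λ i → monomial (cycleType (attach i ρ))) ∎

  cycle-expansion : ∀ n → ∂^ n (g 0) ≈ ∑ (permutations n) (λ w → monomial (cycleType w))
  cycle-expansion zero    = ≈-sym (≈-trans (+-identityʳ _) (*-identityˡ _))
  cycle-expansion (suc n) = begin
    ∂ (∂^ n (g 0))
      ≈⟨ ∂-cong (cycle-expansion n) ⟩
    ∂ (∑ (permutations n) (λ w → monomial (cycleType w)))
      ≈⟨ ∂-∑ (permutations n) (λ w → monomial (cycleType w)) ⟩
    ∑ (permutations n) (λ ρ → ∂ (monomial (cycleType ρ)))
      ≈⟨ ∑-cong (permutations n) ∂-monomial-cycleType ⟩
    ∑ (permutations n) (λ ρ → ∑ (allFin (suc n)) (λ i → monomial (cycleType (attach i ρ))))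
      ≈⟨ ∑-swap (permutations n) (allFin (suc n)) (λ ρ i → monomial (cycleType (attach i ρ))) ⟩
    ∑ (allFin (suc n)) (λ i → ∑ (permutations n) (λ ρ → monomial (cycleType (attach i ρ))))
      ≈⟨ ∑-attach commutativeRing n (λ {v} {w} e → monomial-cong {cycleType v} {cycleType w} (cycleType-cong {v = v} {w} e)) ⟨
    ∑ (permutations (suc n)) (λ w → monomial (cycleType w)) ∎

-- Descents

punchIn-<⁺ : ∀ {n} (i : Fin (suc n)) (k : Fin n) → toℕ k ℕ.< toℕ i → punchIn i k Fin.< i
punchIn-<⁺ (suc i) zero    _         = s≤s z≤n
punchIn-<⁺ (suc i) (suc k) (s≤s k<i) = s≤s (punchIn-<⁺ i k k<i)

punchIn-<⁻ : ∀ {n} (i : Fin (suc n)) (k : Fin n) → punchIn i k Fin.< i → toℕ k ℕ.< toℕ i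
punchIn-<⁻ (suc i) zero    _         = s≤s z≤n
punchIn-<⁻ (suc i) (suc k) (s≤s k<i) = s≤s (punchIn-<⁻ i k k<i)

module _ {n : ℕ} (i : Fin (suc (suc n))) (σ : Permutation′ (suc n)) where

  isDescent-insert-zero : IsDescent (insert zero i σ) zero → toℕ (σ ⟨$⟩ʳ zero) ℕ.< toℕ i
  isDescent-insert-zero (suc zero , _ , lt) =
    punchIn-<⁻ i (σ ⟨$⟩ʳ zero) (subst (Fin._< i) (Perm.insert-punchIn zero i σ zero) lt)

  insert-zero-isDescent : toℕ (σ ⟨$⟩ʳ zero) ℕ.< toℕ i → IsDescent (insert zero i σ) zero
  insert-zero-isDescent lt =
    suc zero , refl , subst (Fin._< i) (sym (Perm.insert-punchIn zero i σ zero)) (punchIn-<⁺ i (σ ⟨$⟩ʳ zero) lt)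

  isDescent-insert-suc : (λ k → IsDescent (insert zero i σ) (suc k)) ≐ IsDescent σ
  isDescent-insert-suc =
      (λ { (suc j , e , lt) → j , ℕ.suc-injective e
         , ℕ.≰⇒> (λ le → ℕ.<⇒≱ lt (subst₂ Fin._≤_ (sym (Perm.insert-punchIn zero i σ _))
             (sym (Perm.insert-punchIn zero i σ j)) (Fin.punchIn-mono-≤ i _ _ le))) })
    , (λ { (j , e , lt) → suc j , cong suc e
         , ℕ.≰⇒> (λ le → ℕ.<⇒≱ lt (Fin.punchIn-cancel-≤ i _ _
             (subst₂ Fin._≤_ (Perm.insert-punchIn zero i σ _) (Perm.insert-punchIn zero i σ j) le))) })

  -- A letter put in front preserves the relative order of the rest, hence their descents; the new
  -- first position is a descent exactly if the old first letter lies below `i`. The Boolean test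
  -- computes to `false` at `i = zero`, which `eulerianFrom-zero` exploits.
  des-insert : des (insert zero i σ) ≡ (if toℕ (σ ⟨$⟩ʳ zero) <ᵇ toℕ i then suc (des σ) else des σ)
  des-insert with toℕ (σ ⟨$⟩ʳ zero) <ᵇ toℕ i in eq
  ... | true  = trans (count-accept (isDescent? (insert zero i σ))
                        (insert-zero-isDescent (ℕ.<ᵇ⇒< _ _ (subst T (sym eq) _))))
                  (cong suc (count-cong (isDescent? (insert zero i σ) ∘ suc) (isDescent? σ) isDescent-insert-suc))
  ... | false = trans (count-reject (isDescent? (insert zero i σ))
                        (λ d → subst T eq (ℕ.<⇒<ᵇ (isDescent-insert-zero d))))
                  (count-cong (isDescent? (insert zero i σ) ∘ suc) (isDescent? σ) isDescent-insert-suc)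

module FirstLetter {c ℓ : Level} (R : CommutativeRing c ℓ) (x : CommutativeRing.Carrier R) where
  open CommutativeRing R hiding (zero) renaming (refl to ≈-refl; sym to ≈-sym; trans to ≈-trans)
  open Sum R
  open import Algebra.Properties.Semiring.Exp semiring using (_^_)
  open import Relation.Binary.Reasoning.Setoid setoid

  step : Bool → Carrier
  step b = if b then x else 1#

  eulerianFrom : ∀ n → Fin (suc n) → Carrier
  eulerianFrom n i = ∑ (permutations n) (λ ρ → x ^ des (insert zero i ρ))

  x^des-insert : ∀ {n} (i : Fin (suc (suc n))) (j : Fin (suc n)) ρ →
    x ^ des (insert zero i (insert zero j ρ)) ≈ step (toℕ j <ᵇ toℕ i) * x ^ des (insert zero j ρ)
  x^des-insert i j ρ = ≈-trans (reflexive (cong (x ^_) (des-insert i (insert zero j ρ)))) (split (toℕ j <ᵇ toℕ i) _)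
    where
    split : ∀ b k → x ^ (if b then suc k else k) ≈ step b * x ^ k
    split true  k = ≈-refl
    split false k = ≈-sym (*-identityˡ _)

  eulerianFrom-suc : ∀ n i → eulerianFrom (suc n) i ≈ ∑ (allFin (suc n)) (λ j → step (toℕ j <ᵇ toℕ i) * eulerianFrom n j)
  eulerianFrom-suc n i = begin
    eulerianFrom (suc n) i
      ≈⟨ ∑-cartesianProductWith (insert zero) (allFin (suc n)) (permutations n) (λ ρ → x ^ des (insert zero i ρ)) ⟩
    ∑ (allFin (suc n)) (λ j → ∑ (permutations n) (λ ρ → x ^ des (insert zero i (insert zero j ρ))))
      ≈⟨ ∑-cong (allFin (suc n)) (λ j → ≈-trans (∑-cong (permutations n) (x^des-insert i j))
           (≈-sym (*-∑ (step (toℕ j <ᵇ toℕ i)) (permutations n) (λ ρ → x ^ des (insert zero j ρ))))) ⟩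
    ∑ (allFin (suc n)) (λ j → step (toℕ j <ᵇ toℕ i) * eulerianFrom n j) ∎

  eulerianFrom-zero : ∀ n → ∑ (permutations n) (λ w → x ^ des w) ≈ eulerianFrom n zero
  eulerianFrom-zero zero    = ≈-refl
  eulerianFrom-zero (suc n) = ∑-cong (permutations (suc n)) (λ w → reflexive (cong (x ^_) (sym (des-insert zero w))))

  prefixSum : ℕ → (ℕ → Carrier) → Carrier
  prefixSum zero    f = 0#
  prefixSum (suc m) f = f 0 + prefixSum m (f ∘ suc)

  ∑-allFin : ∀ m f → ∑ (allFin m) (f ∘ toℕ) ≈ prefixSum m f
  ∑-allFin zero    f = ≈-refl
  ∑-allFin (suc m) f = ≈-trans (∑-allFin-suc {m} (f ∘ toℕ)) (+-congˡ (∑-allFin m (f ∘ suc)))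

  prefixSum-suc : ∀ m f → prefixSum (suc m) f ≈ prefixSum m f + f m
  prefixSum-suc zero    f = +-comm _ _
  prefixSum-suc (suc m) f = ≈-trans (+-congˡ (prefixSum-suc m (f ∘ suc))) (≈-sym (+-assoc _ _ _))

  module _ (d : Carrier) (d+x≈1 : d + x ≈ 1#) (d-cancel : ∀ {a b} → d * a ≈ d * b → a ≈ b)
    (ε : ℕ → ℕ → Carrier) (ε-00 : ε 0 0 ≈ 1#)
    (ε-suc : ∀ i k → ε (suc i) k + d * ε i k ≈ ε i (suc k))
    (ε-last : ∀ n → ε (suc n) 0 ≈ x * ε 0 (suc n)) where

    open import Algebra.Properties.Group +-group using (∙-cancelʳ)
    open import Algebra.Solver.Ring.NaturalCoefficients.Default commutativeSemiring using (solve; _:=_; _:+_; _:*_; con)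

    -- The terms with j < i carry the weight x and the others 1; adding d = 1 - x times the former
    -- makes all weights 1.
    ∑-step : ∀ m i f → i ℕ.≤ m →
             ∑ (allFin m) (λ j → step (toℕ j <ᵇ i) * f (toℕ j)) + d * prefixSum i f ≈ prefixSum m f
    ∑-step m zero f _ = begin
      ∑ (allFin m) (λ j → 1# * f (toℕ j)) + d * 0#  ≈⟨ +-cong (∑-cong (allFin m) (λ j → *-identityˡ _)) (zeroʳ d) ⟩
      ∑ (allFin m) (f ∘ toℕ) + 0#                   ≈⟨ +-identityʳ _ ⟩
      ∑ (allFin m) (f ∘ toℕ)                        ≈⟨ ∑-allFin m f ⟩
      prefixSum m f                                 ∎
    ∑-step (suc m) (suc i) f (s≤s i≤m) = begin
      ∑ (allFin (suc m)) (λ j → step (toℕ j <ᵇ suc i) * f (toℕ j)) + d * prefixSum (suc i) f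
        ≈⟨ +-congʳ (∑-allFin-suc {m} (λ j → step (toℕ j <ᵇ suc i) * f (toℕ j))) ⟩
      (x * f 0 + s) + d * (f 0 + prefixSum i (f ∘ suc))
        ≈⟨ solve 5 (λ x d f₀ s p → (x :* f₀ :+ s) :+ d :* (f₀ :+ p) := (d :+ x) :* f₀ :+ (s :+ d :* p)) ≈-refl x d (f 0) s _ ⟩
      (d + x) * f 0 + (s + d * prefixSum i (f ∘ suc))
        ≈⟨ +-cong (≈-trans (*-congʳ d+x≈1) (*-identityˡ _)) (∑-step m i (f ∘ suc) i≤m) ⟩
      f 0 + prefixSum m (f ∘ suc) ∎
      where
      s = ∑ (allFin m) (λ j → step (toℕ j <ᵇ i) * f (suc (toℕ j)))

    private
      row : ℕ → ℕ → Carrier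
      row n j = ε j (n ℕ.∸ j)

    -- The sum telescopes: by `ε-suc`, d·ε i (n - i) is the difference of ε i (n + 1 - i) and ε (i +
    -- 1) (n - i).
    ε-prefixSum : ∀ n i → i ℕ.≤ suc n → ε i (suc n ℕ.∸ i) + d * prefixSum i (row n) ≈ ε 0 (suc n)
    ε-prefixSum n zero    _         = ≈-trans (+-congˡ (zeroʳ d)) (+-identityʳ _)
    ε-prefixSum n (suc i) (s≤s i≤n) = begin
      ε (suc i) (n ℕ.∸ i) + d * prefixSum (suc i) (row n)
        ≈⟨ +-congˡ (*-congˡ (prefixSum-suc i (row n))) ⟩
      ε (suc i) (n ℕ.∸ i) + d * (prefixSum i (row n) + ε i (n ℕ.∸ i))
        ≈⟨ solve 4 (λ d a p e → a :+ d :* (p :+ e) := (a :+ d :* e) :+ d :* p) ≈-refl d _ _ _ ⟩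
      (ε (suc i) (n ℕ.∸ i) + d * ε i (n ℕ.∸ i)) + d * prefixSum i (row n)
        ≈⟨ +-congʳ (ε-suc i (n ℕ.∸ i)) ⟩
      ε i (suc (n ℕ.∸ i)) + d * prefixSum i (row n)
        ≡⟨ cong (λ k → ε i k + d * prefixSum i (row n)) (ℕ.+-∸-assoc 1 i≤n) ⟨
      ε i (suc n ℕ.∸ i) + d * prefixSum i (row n)
        ≈⟨ ε-prefixSum n i (ℕ.m≤n⇒m≤1+n i≤n) ⟩
      ε 0 (suc n) ∎

    -- For i = n + 1 the telescoped sum ends in `ε (suc n) 0`, which is x·ε 0 (n + 1) by `ε-last`.
    -- What remains is d times the claim, because 1 - x = d.
    ε-prefixSum-full : ∀ n → prefixSum (suc n) (row n) ≈ ε 0 (suc n)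
    ε-prefixSum-full n = d-cancel (∙-cancelʳ (x * ε 0 (suc n)) _ _ (begin
      d * prefixSum (suc n) (row n) + x * ε 0 (suc n)  ≈⟨ +-comm _ _ ⟩
      x * ε 0 (suc n) + d * prefixSum (suc n) (row n)  ≈⟨ +-congʳ (ε-last n) ⟨
      ε (suc n) 0 + d * prefixSum (suc n) (row n)
        ≡⟨ cong (λ k → ε (suc n) k + d * prefixSum (suc n) (row n)) (ℕ.n∸n≡0 n) ⟨
      ε (suc n) (n ℕ.∸ n) + d * prefixSum (suc n) (row n)
                                                       ≈⟨ ε-prefixSum n (suc n) ℕ.≤-refl ⟩
      ε 0 (suc n)                                      ≈⟨ ≈-trans (*-congʳ d+x≈1) (*-identityˡ _) ⟨
      (d + x) * ε 0 (suc n)                            ≈⟨ distribʳ _ _ _ ⟩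
      d * ε 0 (suc n) + x * ε 0 (suc n)                ∎))

    eulerianFrom≈ε : ∀ n i → eulerianFrom n i ≈ ε (toℕ i) (n ℕ.∸ toℕ i)
    eulerianFrom≈ε zero    zero = ≈-trans (+-identityʳ _) (≈-sym ε-00)
    eulerianFrom≈ε (suc n) i    = ∙-cancelʳ (d * prefixSum (toℕ i) (row n)) _ _ (begin
      eulerianFrom (suc n) i + d * prefixSum (toℕ i) (row n)
        ≈⟨ +-congʳ (≈-trans (eulerianFrom-suc n i)
             (∑-cong (allFin (suc n)) (λ j → *-congˡ {step (toℕ j <ᵇ toℕ i)} (eulerianFrom≈ε n j)))) ⟩
      ∑ (allFin (suc n)) (λ j → step (toℕ j <ᵇ toℕ i) * row n (toℕ j)) + d * prefixSum (toℕ i) (row n)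
        ≈⟨ ∑-step (suc n) (toℕ i) (row n) (Fin.toℕ≤pred[n] i) ⟩
      prefixSum (suc n) (row n)
        ≈⟨ ε-prefixSum-full n ⟩
      ε 0 (suc n)
        ≈⟨ ε-prefixSum n (toℕ i) (Fin.toℕ≤pred[n] i) ⟨
      ε (toℕ i) (suc n ℕ.∸ toℕ i) + d * prefixSum (toℕ i) (row n) ∎)

    ∑-x^des : ∀ n → ∑ (permutations n) (λ w → x ^ des w) ≈ ε 0 n
    ∑-x^des n = ≈-trans (eulerianFrom-zero n) (eulerianFrom≈ε n zero)

-- Polynomials with rational coefficients

fromℕ-suc : ∀ m → fromℕ (suc m) ≡ 1ℚ ℚ.+ fromℕ m
fromℕ-suc m = ℚ.toℚᵘ-injective (begin-equality
  toℚᵘ (fromℕ (suc m))                     ≃⟨ ℚ.toℚᵘ-fromℚᵘ (mkℚᵘ (ℤ.+ suc m) 0) ⟩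
  mkℚᵘ (ℤ.+ suc m) 0                         ≃⟨ *≡* (cong (ℤ._* ℤ.+ 1) (cong (ℤ._+_ (ℤ.+ 1)) (sym (ℤ.*-identityʳ (ℤ.+ m))))) ⟩
  toℚᵘ 1ℚ ℚᵘ.+ mkℚᵘ (ℤ.+ m) 0                ≃⟨ ℚᵘ.+-congʳ (toℚᵘ 1ℚ) (ℚ.toℚᵘ-fromℚᵘ (mkℚᵘ (ℤ.+ m) 0)) ⟨
  toℚᵘ 1ℚ ℚᵘ.+ toℚᵘ (fromℕ m)              ≃⟨ ℚ.toℚᵘ-homo-+ 1ℚ (fromℕ m) ⟨
  toℚᵘ (1ℚ ℚ.+ fromℕ m)                    ∎)
  where open ℚᵘ.≤-Reasoning

1/n*n : ∀ n .{{_ : NonZero n}} → (ℤ.+ 1 ℚ./ n) ℚ.* fromℕ n ≡ 1ℚ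
1/n*n n@(suc k) = ℚ.toℚᵘ-injective (begin-equality
  toℚᵘ ((ℤ.+ 1 ℚ./ n) ℚ.* fromℕ n)           ≃⟨ ℚ.toℚᵘ-homo-* (ℤ.+ 1 ℚ./ n) (fromℕ n) ⟩
  toℚᵘ (ℤ.+ 1 ℚ./ n) ℚᵘ.* toℚᵘ (fromℕ n)     ≃⟨ ℚᵘ.*-cong (ℚ.toℚᵘ-fromℚᵘ (mkℚᵘ (ℤ.+ 1) k)) (ℚ.toℚᵘ-fromℚᵘ (mkℚᵘ (ℤ.+ n) 0)) ⟩
  mkℚᵘ (ℤ.+ 1) k ℚᵘ.* mkℚᵘ (ℤ.+ n) 0           ≃⟨ *≡* (trans (ℤ.*-identityʳ _) (sym (cong (ℤ._*_ (ℤ.+ 1)) (cong ℤ.+_ (ℕ.*-identityʳ n))))) ⟩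
  toℚᵘ 1ℚ                                  ∎)
  where open ℚᵘ.≤-Reasoning

private
  module ℚR where
    open CommutativeRing ℚ.+-*-commutativeRing public hiding (zero)
    open import Algebra.Properties.Semiring.Mult semiring public renaming (_×_ to infixr 8 _•_)
    open import Algebra.Properties.CommutativeSemigroup *-commutativeSemigroup public using (x∙yz≈y∙xz)

•≡fromℕ* : ∀ n q → n ℚR.• q ≡ fromℕ n ℚ.* q
•≡fromℕ* zero    q = sym (ℚ.*-zeroˡ q)
•≡fromℕ* (suc n) q = begin
  q ℚ.+ n ℚR.• q                    ≡⟨ cong₂ ℚ._+_ (sym (ℚ.*-identityˡ q)) (•≡fromℕ* n q) ⟩
  1ℚ ℚ.* q ℚ.+ fromℕ n ℚ.* q        ≡⟨ ℚ.*-distribʳ-+ q 1ℚ (fromℕ n) ⟨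
  (1ℚ ℚ.+ fromℕ n) ℚ.* q            ≡⟨ cong (ℚ._* q) (fromℕ-suc n) ⟨
  fromℕ (suc n) ℚ.* q               ∎
  where open ≡.≡-Reasoning

fromℕ-* : ∀ m n → fromℕ (m ℕ.* n) ≡ fromℕ m ℚ.* fromℕ n
fromℕ-* m n = begin
  fromℕ (m ℕ.* n)              ≡⟨ ℚ.*-identityʳ _ ⟨
  fromℕ (m ℕ.* n) ℚ.* 1ℚ       ≡⟨ •≡fromℕ* (m ℕ.* n) 1ℚ ⟨
  (m ℕ.* n) ℚR.• 1ℚ            ≡⟨ ℚR.×1-homo-* m n ⟩
  (m ℚR.• 1ℚ) ℚ.* (n ℚR.• 1ℚ)  ≡⟨ cong₂ ℚ._*_ (trans (•≡fromℕ* m 1ℚ) (ℚ.*-identityʳ (fromℕ m)))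
                                     (trans (•≡fromℕ* n 1ℚ) (ℚ.*-identityʳ (fromℕ n))) ⟩
  fromℕ m ℚ.* fromℕ n          ∎
  where open ≡.≡-Reasoning

1/n!*m! : ∀ m → 1/ suc m ! ℚ.* fromℕ (m !) ≡ ℤ.+ 1 ℚ./ suc m
1/n!*m! m = begin
  1/ suc m ! ℚ.* fromℕ (m !)
    ≡⟨ ℚ.*-identityˡ _ ⟨
  1ℚ ℚ.* (1/ suc m ! ℚ.* fromℕ (m !))
    ≡⟨ cong (ℚ._* (1/ suc m ! ℚ.* fromℕ (m !))) (1/n*n (suc m)) ⟨
  (ℤ.+ 1 ℚ./ suc m) ℚ.* fromℕ (suc m) ℚ.* (1/ suc m ! ℚ.* fromℕ (m !))
    ≡⟨ ℚ.*-assoc (ℤ.+ 1 ℚ./ suc m) (fromℕ (suc m)) _ ⟩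
  (ℤ.+ 1 ℚ./ suc m) ℚ.* (fromℕ (suc m) ℚ.* (1/ suc m ! ℚ.* fromℕ (m !)))
    ≡⟨ cong ((ℤ.+ 1 ℚ./ suc m) ℚ.*_) (trans (ℚR.x∙yz≈y∙xz (fromℕ (suc m)) (1/ suc m !) (fromℕ (m !)))
         (trans (cong (1/ suc m ! ℚ.*_) (sym (fromℕ-* (suc m) (m !)))) (1/n*n (suc m !) {{ℕ._!≢0 (suc m)}}))) ⟩
  (ℤ.+ 1 ℚ./ suc m) ℚ.* 1ℚ
    ≡⟨ ℚ.*-identityʳ _ ⟩
  ℤ.+ 1 ℚ./ suc m ∎
  where open ≡.≡-Reasoning

module Q = PowerSeries ℚ.+-*-commutativeRing

ℚ⟦x⟧ : CommutativeRing 0ℓ 0ℓ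
ℚ⟦x⟧ = Q.seriesRing

module R where
  open CommutativeRing ℚ⟦x⟧ public hiding (zero)
  open import Algebra.Properties.Semiring.Mult semiring public renaming (_×_ to infixr 8 _•_)
  open import Algebra.Properties.Semiring.Exp semiring public using (_^_)
  open Sum ℚ⟦x⟧ public

x : R.Carrier
x = Q.shift R.1#

x-* : ∀ f → x R.* f R.≈ Q.shift f
x-* f zero    = Q.shift-⊛ R.1# f zero
x-* f (suc k) = trans (Q.shift-⊛ R.1# f (suc k)) (R.*-identityˡ f k)

R-•-coeff : ∀ n f k → (n R.• f) k ≡ n ℚR.• f k
R-•-coeff zero    f k = refl
R-•-coeff (suc n) f k = cong (f k ℚ.+_) (R-•-coeff n f k)

•-inverse : ∀ n → suc n R.• Q.const (ℤ.+ 1 ℚ./ suc n) R.≈ R.1#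
•-inverse n zero    = trans (R-•-coeff (suc n) (Q.const (ℤ.+ 1 ℚ./ suc n)) 0) (trans (•≡fromℕ* (suc n) (ℤ.+ 1 ℚ./ suc n))
  (trans (ℚ.*-comm (fromℕ (suc n)) (ℤ.+ 1 ℚ./ suc n)) (1/n*n (suc n))))
•-inverse n (suc k) = trans (R-•-coeff (suc n) (Q.const (ℤ.+ 1 ℚ./ suc n)) (suc k))
  (trans (•≡fromℕ* (suc n) 0ℚ) (ℚ.*-zeroʳ (fromℕ (suc n))))

open Parametrisation ℚ⟦x⟧ x (λ n → Q.const (ℤ.+ 1 ℚ./ suc n)) •-inverse

-- From f = (1 - x)f + xf, each coefficient of f is determined by (1 - x)f and the preceding
-- coefficient of f.
[1-x]-cancel : ∀ {f g} → (R.1# R.+ R.- x) R.* f R.≈ (R.1# R.+ R.- x) R.* g → f R.≈ g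
[1-x]-cancel {f} {g} p k = trans (sym (expand f k)) (trans (step k) (expand g k))
  where
  d₁ = R.1# R.+ R.- x
  expand : ∀ h k → (d₁ R.* h R.+ Q.shift h) k ≡ h k
  expand h = R.trans (R.+-congˡ {d₁ R.* h} (R.sym (x-* h)))
    (R.trans (R.sym (R.distribʳ h d₁ x)) (R.trans (R.*-congʳ {h} d+x≈1) (R.*-identityˡ h)))
  step : ∀ k → (d₁ R.* f R.+ Q.shift f) k ≡ (d₁ R.* g R.+ Q.shift g) k
  step zero    = cong (ℚ._+ 0ℚ) (p 0)
  step (suc k) = cong₂ ℚ._+_ (p (suc k)) ([1-x]-cancel {f} {g} p k)

coeff-+ : ∀ p q → coeff (p +ₚ q) R.≈ coeff p R.+ coeff q
coeff-+ []      q       k       = sym (ℚ.+-identityˡ _)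
coeff-+ (a ∷ p) []      k       = sym (ℚ.+-identityʳ _)
coeff-+ (a ∷ p) (b ∷ q) zero    = refl
coeff-+ (a ∷ p) (b ∷ q) (suc k) = coeff-+ p q k

coeff-· : ∀ c p k → coeff (c ·ₚ p) k ≡ c ℚ.* coeff p k
coeff-· c []      k       = sym (ℚ.*-zeroʳ c)
coeff-· c (a ∷ p) zero    = refl
coeff-· c (a ∷ p) (suc k) = coeff-· c p k

coeff-* : ∀ p q → coeff (p *ₚ q) R.≈ coeff p R.* coeff q
coeff-* []      q k       = sym (R.zeroˡ (coeff q) k)
coeff-* (a ∷ p) q zero    = trans (coeff-+ (a ·ₚ q) _ zero) (trans (ℚ.+-identityʳ _) (coeff-· a q zero))
coeff-* (a ∷ p) q (suc k) = trans (coeff-+ (a ·ₚ q) _ (suc k)) (cong₂ ℚ._+_ (coeff-· a q (suc k)) (coeff-* p q k))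

coeff-1 : coeff 1ₚ R.≈ R.1#
coeff-1 zero    = refl
coeff-1 (suc k) = refl

coeff-x^ : ∀ n → coeff (x^ n) R.≈ x R.^ n
coeff-x^ zero    = coeff-1
coeff-x^ (suc n) k = sym (trans (x-* (x R.^ n) k) (lemma k))
  where
  lemma : ∀ k → Q.shift (x R.^ n) k ≡ coeff (x^ suc n) k
  lemma zero    = refl
  lemma (suc k) = sym (coeff-x^ n k)

coeff-sum : ∀ {A : Set} (f : A → Poly) xs → coeff (sumₚ (map f xs)) R.≈ R.∑ xs (coeff ∘ f)
coeff-sum f []       = λ _ → refl
coeff-sum f (y ∷ xs) = R.trans (coeff-+ (f y) _) (R.+-congˡ {coeff (f y)} (coeff-sum f xs))

coeff-product : ∀ {A : Set} (f : A → Poly) xs → coeff (productₚ (map f xs)) R.≈ R.∏ xs (coeff ∘ f)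
coeff-product f []       = coeff-1
coeff-product f (y ∷ xs) = R.trans (coeff-* (f y) _) (R.*-congˡ {coeff (f y)} (coeff-product f xs))

coeff-applyUpTo-< : ∀ (c : ℕ → ℚ) {n k} → k ℕ.< n → coeff (applyUpTo c n) k ≡ c k
coeff-applyUpTo-< c {suc n} {zero}  _         = refl
coeff-applyUpTo-< c {suc n} {suc k} (s≤s k<n) = coeff-applyUpTo-< (c ∘ suc) k<n

coeff-applyUpTo-≥ : ∀ (c : ℕ → ℚ) {n k} → n ℕ.≤ k → coeff (applyUpTo c n) k ≡ 0ℚ
coeff-applyUpTo-≥ c {zero}  {k}     _         = refl
coeff-applyUpTo-≥ c {suc n} {suc k} (s≤s n≤k) = coeff-applyUpTo-≥ (c ∘ suc) n≤k

coeff-eulerian : ∀ n → coeff (eulerian n) R.≈ g n 0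
coeff-eulerian n = begin
  coeff (eulerian n)                            ≈⟨ coeff-sum (λ w → x^ des w) (permutations n) ⟩
  R.∑ (permutations n) (λ w → coeff (x^ des w)) ≈⟨ R.∑-cong (permutations n) (λ w → coeff-x^ (des w)) ⟩
  R.∑ (permutations n) (λ w → x R.^ des w)
    ≈⟨ FirstLetter.∑-x^des ℚ⟦x⟧ x (R.1# R.+ R.- x) d+x≈1 (λ {f} {g} → [1-x]-cancel {f} {g}) ε ε-00 ε-suc ε-last n ⟩
  g n 0                                         ∎
  where open import Relation.Binary.Reasoning.Setoid R.setoid

-- Powers of φ and the Narayana polynomials of types A and B

term : ℚ → ℕ → R.Carrier
term q zero    = Q.const q
term q (suc j) = Q.shift (term q j)

•x^ : ∀ n j → n R.• x R.^ j R.≈ term (fromℕ n) j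
•x^ n zero    zero    = trans (R-•-coeff n R.1# 0) (trans (•≡fromℕ* n 1ℚ) (ℚ.*-identityʳ (fromℕ n)))
•x^ n zero    (suc k) = trans (R-•-coeff n R.1# (suc k)) (trans (•≡fromℕ* n 0ℚ) (ℚ.*-zeroʳ (fromℕ n)))
•x^ n (suc j) k = trans (R.sym (R.×-comm-* n x (x R.^ j)) k) (trans (x-* (n R.• x R.^ j) k) (lemma k))
  where
  lemma : ∀ k → Q.shift (n R.• x R.^ j) k ≡ Q.shift (term (fromℕ n) j) k
  lemma zero    = refl
  lemma (suc k) = •x^ n j k

private
  module S = PowerSeries ℚ⟦x⟧

-- For the convolution in u, x is a scalar, so a common factor x comes out of the product.
shift-⊛-inner : ∀ f h m k → ((λ j → Q.shift (f j)) S.⊛ h) m k ≡ Q.shift ((f S.⊛ h) m) k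
shift-⊛-inner f h zero    k       = Q.shift-⊛ (f 0) (h 0) k
shift-⊛-inner f h (suc m) zero    = cong₂ ℚ._+_ (Q.shift-⊛ (f 0) (h (suc m)) zero) (shift-⊛-inner (f ∘ suc) h m zero)
shift-⊛-inner f h (suc m) (suc k) = cong₂ ℚ._+_ (Q.shift-⊛ (f 0) (h (suc m)) (suc k)) (shift-⊛-inner (f ∘ suc) h m (suc k))

-- In the sum of αⱼxʲ·γₘ₋ⱼ over j only j = k contributes to xᵏ. The induction splits off j = 0 and
-- takes one x out of all other terms.
coeff-term-⊛-≤ : ∀ (α γ : ℕ → ℚ) {m k} → k ℕ.≤ m →
                  ((λ j → term (α j) j) S.⊛ (λ j → Q.const (γ j))) m k ≡ α k ℚ.* γ (m ℕ.∸ k)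
coeff-term-⊛-≤ α γ {zero}  {zero}  _ = refl
coeff-term-⊛-≤ α γ {suc m} {zero}  _ = trans
  (cong (α 0 ℚ.* γ (suc m) ℚ.+_) (shift-⊛-inner (λ j → term (α (suc j)) j) (λ j → Q.const (γ j)) m 0))
  (ℚ.+-identityʳ (α 0 ℚ.* γ (suc m)))
coeff-term-⊛-≤ α γ {suc m} {suc k} (s≤s k≤m) = trans
  (cong₂ ℚ._+_ (trans (Q.const-⊛ (α 0) (Q.const (γ (suc m))) (suc k)) (ℚ.*-zeroʳ (α 0)))
    (trans (shift-⊛-inner (λ j → term (α (suc j)) j) (λ j → Q.const (γ j)) m (suc k)) (coeff-term-⊛-≤ (α ∘ suc) γ k≤m)))
  (ℚ.+-identityˡ (α (suc k) ℚ.* γ (m ℕ.∸ k)))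

coeff-term-⊛-> : ∀ (α γ : ℕ → ℚ) {m k} → m ℕ.< k →
                  ((λ j → term (α j) j) S.⊛ (λ j → Q.const (γ j))) m k ≡ 0ℚ
coeff-term-⊛-> α γ {zero}  {suc k} _ = trans (Q.const-⊛ (α 0) (Q.const (γ 0)) (suc k)) (ℚ.*-zeroʳ (α 0))
coeff-term-⊛-> α γ {suc m} {suc k} (s≤s m<k) = trans
  (cong₂ ℚ._+_ (trans (Q.const-⊛ (α 0) (Q.const (γ (suc m))) (suc k)) (ℚ.*-zeroʳ (α 0)))
    (trans (shift-⊛-inner (λ j → term (α (suc j)) j) (λ j → Q.const (γ j)) m (suc k)) (coeff-term-⊛-> (α ∘ suc) γ m<k)))
  (ℚ.+-identityˡ 0ℚ)

private
  module D where
    open DifferentialRing derivationD public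
    open import Algebra.Properties.Semiring.Exp semiring public using (_^_)
    open import Algebra.Properties.CommutativeSemiring.Exp commutativeSemiring public using (^-distrib-*)

const-linear-^ : ∀ n j → (a D.^ n) j R.≈ Q.const (fromℕ (n C j))
const-linear-^ n j = R.trans (linear-^ R.1# n j) (R.trans (R.×-congʳ (n C j) (1^n≈1 j)) (•x^ (n C j) 0))
  where
  1^n≈1 : ∀ n → R.1# R.^ n R.≈ R.1#
  1^n≈1 zero    = R.refl {R.1#}
  1^n≈1 (suc n) = R.trans (R.*-identityˡ (R.1# R.^ n)) (1^n≈1 n)

φ^-coeff : ∀ n m → (φ D.^ n) m R.≈ ((λ j → term (fromℕ (n C j)) j) S.⊛ (λ j → Q.const (fromℕ (n C j)))) m
φ^-coeff n m = begin
  (φ D.^ n) m                 ≈⟨ D.^-distrib-* a c′ n m ⟩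
  (a D.^ n D.* c′ D.^ n) m    ≈⟨ D.*-comm (a D.^ n) (c′ D.^ n) m ⟩
  (c′ D.^ n D.* a D.^ n) m    ≈⟨ S.⊛-cong (λ j → R.trans (linear-^ x n j) (•x^ (n C j) j)) (const-linear-^ n) m ⟩
  ((λ j → term (fromℕ (n C j)) j) S.⊛ (λ j → Q.const (fromℕ (n C j)))) m ∎
  where open import Relation.Binary.Reasoning.Setoid R.setoid

φ^-coeff-≤ : ∀ n {m k} → k ℕ.≤ m → (φ D.^ n) m k ≡ fromℕ (n C k) ℚ.* fromℕ (n C (m ℕ.∸ k))
φ^-coeff-≤ n {m} {k} k≤m = trans (φ^-coeff n m k) (coeff-term-⊛-≤ (λ j → fromℕ (n C j)) (λ j → fromℕ (n C j)) k≤m)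

φ^-coeff-> : ∀ n {m k} → m ℕ.< k → (φ D.^ n) m k ≡ 0ℚ
φ^-coeff-> n {m} {k} m<k = trans (φ^-coeff n m k) (coeff-term-⊛-> (λ j → fromℕ (n C j)) (λ j → fromℕ (n C j)) m<k)

coeff-narayanaB : ∀ n → coeff (narayanaB n) R.≈ b n 0
coeff-narayanaB zero    k = refl
coeff-narayanaB (suc m) k = trans (lemma (k ℕ.≤? m)) (sym (b-0 m k))
  where
  lemma : Dec (k ℕ.≤ m) → coeff (narayanaB (suc m)) k ≡ (φ D.^ m) m k
  lemma (yes k≤m) = begin
    coeff (narayanaB (suc m)) k                ≡⟨ coeff-applyUpTo-< (λ k → fromℕ ((m C k) ℕ.^ 2)) (s≤s k≤m) ⟩
    fromℕ ((m C k) ℕ.^ 2)                      ≡⟨ cong (λ c → fromℕ ((m C k) ℕ.* c)) (ℕ.*-identityʳ (m C k)) ⟩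
    fromℕ ((m C k) ℕ.* (m C k))                ≡⟨ fromℕ-* (m C k) (m C k) ⟩
    -- Symmetry turns the square into the product found in the coefficient of uᵐ in (1 + xu)ᵐ(1 +
    -- u)ᵐ.
    fromℕ (m C k) ℚ.* fromℕ (m C k)            ≡⟨ cong (λ c → fromℕ (m C k) ℚ.* fromℕ c) (nCk≡nC[n∸k] k≤m) ⟩
    fromℕ (m C k) ℚ.* fromℕ (m C (m ℕ.∸ k))    ≡⟨ φ^-coeff-≤ m k≤m ⟨
    (φ D.^ m) m k                              ∎
    where open ≡.≡-Reasoning
  lemma (no k≰m) = trans (coeff-applyUpTo-≥ (λ k → fromℕ ((m C k) ℕ.^ 2)) (ℕ.≰⇒> k≰m))
                         (sym (φ^-coeff-> m (ℕ.≰⇒> k≰m)))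

coeff-narayana : ∀ m k → coeff (narayana (suc m)) k ≡ (ℤ.+ 1 ℚ./ suc m) ℚ.* (φ D.^ suc m) m k
coeff-narayana m k = lemma (k ℕ.≤? m)
  where
  c = λ k → (ℤ.+ 1 ℚ./ suc m) ℚ.* fromℕ (suc m C k) ℚ.* fromℕ (suc m C suc k)
  lemma : Dec (k ℕ.≤ m) → coeff (applyUpTo c (suc m)) k ≡ (ℤ.+ 1 ℚ./ suc m) ℚ.* (φ D.^ suc m) m k
  lemma (yes k≤m) = begin
    coeff (applyUpTo c (suc m)) k
      ≡⟨ coeff-applyUpTo-< c (s≤s k≤m) ⟩
    (ℤ.+ 1 ℚ./ suc m) ℚ.* fromℕ (suc m C k) ℚ.* fromℕ (suc m C suc k)
      ≡⟨ ℚ.*-assoc (ℤ.+ 1 ℚ./ suc m) (fromℕ (suc m C k)) (fromℕ (suc m C suc k)) ⟩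
    (ℤ.+ 1 ℚ./ suc m) ℚ.* (fromℕ (suc m C k) ℚ.* fromℕ (suc m C suc k))
      -- Symmetry again: (m + 1) - (k + 1) = m - k, as the coefficient of uᵐ in φᵐ⁺¹ requires.
      ≡⟨ cong (λ c → (ℤ.+ 1 ℚ./ suc m) ℚ.* (fromℕ (suc m C k) ℚ.* fromℕ c)) (nCk≡nC[n∸k] (s≤s k≤m)) ⟩
    (ℤ.+ 1 ℚ./ suc m) ℚ.* (fromℕ (suc m C k) ℚ.* fromℕ (suc m C (m ℕ.∸ k)))
      ≡⟨ cong ((ℤ.+ 1 ℚ./ suc m) ℚ.*_) (φ^-coeff-≤ (suc m) k≤m) ⟨
    (ℤ.+ 1 ℚ./ suc m) ℚ.* (φ D.^ suc m) m k ∎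
    where open ≡.≡-Reasoning
  lemma (no k≰m) = trans (coeff-applyUpTo-≥ c (ℕ.≰⇒> k≰m))
    (sym (trans (cong ((ℤ.+ 1 ℚ./ suc m) ℚ.*_) (φ^-coeff-> (suc m) (ℕ.≰⇒> k≰m))) (ℚ.*-zeroʳ (ℤ.+ 1 ℚ./ suc m))))

-- Evaluation at u = 0

∑-0-coeff : ∀ {A : Set} (xs : List A) f → D.∑ xs f 0 ≡ R.∑ xs (λ y → f y 0)
∑-0-coeff []       f = refl
∑-0-coeff (y ∷ xs) f = cong (f y 0 R.+_) (∑-0-coeff xs f)

∏-0-coeff : ∀ {A : Set} (xs : List A) f → D.∏ xs f 0 ≡ R.∏ xs (λ y → f y 0)
∏-0-coeff []       f = refl
∏-0-coeff (y ∷ xs) f = cong (f y 0 R.*_) (∏-0-coeff xs f)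

open CycleWeights weights using (monomial)

coeff-monomial : ∀ ks → coeff (productₚ (map narayanaB ks) *ₚ eulerian (length ks)) R.≈ monomial ks 0
coeff-monomial ks = begin
  coeff (productₚ (map narayanaB ks) *ₚ eulerian (length ks))
    ≈⟨ coeff-* (productₚ (map narayanaB ks)) (eulerian (length ks)) ⟩
  coeff (productₚ (map narayanaB ks)) R.* coeff (eulerian (length ks))
    ≈⟨ R.*-cong (R.trans (coeff-product narayanaB ks) (R.∏-cong ks coeff-narayanaB)) (coeff-eulerian (length ks)) ⟩
  R.∏ ks (λ k → b k 0) R.* g (length ks) 0
    ≡⟨ cong (R._* g (length ks) 0) (∏-0-coeff ks b) ⟨
  monomial ks 0 ∎
  where open import Relation.Binary.Reasoning.Setoid R.setoid

coeff-sum-monomials : ∀ m →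
  coeff (sumₚ (map (λ w → narayanaB-perm w *ₚ eulerian (numCycles w)) (permutations (suc m)))) R.≈
  (m !) R.• (φ D.^ suc m) m
coeff-sum-monomials m = begin
  coeff (sumₚ (map (λ w → narayanaB-perm w *ₚ eulerian (numCycles w)) (permutations (suc m))))
    ≈⟨ coeff-sum (λ w → narayanaB-perm w *ₚ eulerian (numCycles w)) (permutations (suc m)) ⟩
  R.∑ (permutations (suc m)) (λ w → coeff (narayanaB-perm w *ₚ eulerian (numCycles w)))
    ≈⟨ R.∑-cong (permutations (suc m)) (λ w → coeff-monomial (cycleType w)) ⟩
  R.∑ (permutations (suc m)) (λ w → monomial (cycleType w) 0)
    ≡⟨ ∑-0-coeff (permutations (suc m)) (λ w → monomial (cycleType w)) ⟨
  D.∑ (permutations (suc m)) (λ w → monomial (cycleType w)) 0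
    ≈⟨ CycleExpansion.cycle-expansion K weights (suc m) 0 ⟨
  K.∂^ (suc m) (g 0) 0
    ≈⟨ ∂^g-0 m ⟩
  (m !) R.• (φ D.^ suc m) m ∎
  where open import Relation.Binary.Reasoning.Setoid R.setoid

corollary5p1 : ∀ (n : ℕ) .{{_ : NonZero n}} →
    narayana n ≈ₚ 1/ n ! ·ₚ sumₚ (map (λ w → narayanaB-perm w *ₚ eulerian (numCycles w)) (permutations n))
corollary5p1 (suc m) k = begin
  coeff (narayana (suc m)) k
    ≡⟨ coeff-narayana m k ⟩
  (ℤ.+ 1 ℚ./ suc m) ℚ.* t
    ≡⟨ cong (ℚ._* t) (1/n!*m! m) ⟨
  1/ suc m ! ℚ.* fromℕ (m !) ℚ.* t
    ≡⟨ ℚ.*-assoc (1/ suc m !) (fromℕ (m !)) t ⟩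
  1/ suc m ! ℚ.* (fromℕ (m !) ℚ.* t)
    ≡⟨ cong (1/ suc m ! ℚ.*_) (trans (R-•-coeff (m !) ((φ D.^ suc m) m) k) (•≡fromℕ* (m !) t)) ⟨
  1/ suc m ! ℚ.* ((m !) R.• (φ D.^ suc m) m) k
    ≡⟨ cong (1/ suc m ! ℚ.*_) (coeff-sum-monomials m k) ⟨
  1/ suc m ! ℚ.* coeff p k
    ≡⟨ coeff-· (1/ suc m !) p k ⟨
  coeff (1/ suc m ! ·ₚ p) k ∎
  where
  open ≡.≡-Reasoning
  t = (φ D.^ suc m) m k
  p = sumₚ (map (λ w → narayanaB-perm w *ₚ eulerian (numCycles w)) (permutations (suc m)))
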